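{- The decision problems $\textsc{MoSm}$ and $\textsc{WoSm}$ are $\mathsf{AC}^0$ many-one reducible to $\textsc{Ccv}\neg$.
   Context: A stable marriage instance consists of $n$ men and $n$ women, each with a preference list totally ordering all persons of the opposite sex. A marriage (perfect matching) $P$ is stable if there are no man $m$ and woman $w$ who each prefer the other to their partner in $P$. The man-optimal (resp. woman-optimal) stable marriage is the stable marriage in which every man (resp. woman) is matched to a partner he (she) likes at least as well as any partner in any stable marriage. $\textsc{MoSm}$ (resp. $\textsc{WoSm}$): given an instance and a designated man-woman pair, decide whether that pair is married in the man-optimal (resp. woman-optimal) stable marriage. $\textsc{Ccv}\neg$: given a comparator circuit which may contain comparator gates (mapping the values $(p,q)$ of two wires to $(p\wedge q,p\vee q)$) and negation gates (flipping the value on one wire), a Boolean input for each wire and a designated wire, decide whether that wire outputs $1$. $A$ is $\mathsf{AC}^0$ many-one reducible to $B$ if there is a uniform $\mathsf{AC}^0$ computable function $F$ with $A(X)\leftrightarrow B(F(X))$. -}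

module Defs where

open import Data.Bool using (Bool; true; false; _∧_; _∨_; not)
open import Data.Bool.ListAction using (any; all)
open import Data.Nat using (ℕ; zero; suc; _+_; _*_; _≤_; _<_; _≡ᵇ_; _≤ᵇ_)
open import Data.Fin using (Fin; toℕ; _≟_)
open import Data.List using (List; []; _∷_; _++_; length; replicate; concat; concatMap; upTo; foldl; lookup)
import Data.List as L
open import Data.Vec using (Vec; _[_]≔_) renaming (lookup to vlookup; toList to vtoList)
open import Data.Product using (Σ; ∃; ∃-syntax; _×_; _,_)
open import Data.Sum using (_⊎_)
open import Relation.Nullary using (¬_)
open import Relation.Nullary.Decidable using (⌊_⌋)
open import Relation.Binary.PropositionalEquality using (_≡_; _≢_)
open import Function.Definitions using (Injective)
open import Function.Bundles using (_⇔_)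

-- Strings: finite bit strings (Cook–Nguyen two-sorted framework).
-- |X| is the length of the list; bit i of X is false outside the string.

Str : Set
Str = List Bool

bit : Str → ℕ → Bool
bit []       _       = false
bit (b ∷ _)  zero    = b
bit (_ ∷ bs) (suc i) = bit bs i

-- Σ^B_0 formulas of the two-sorted language L²_A = [0,1,+,·,|·|,∈,≤,=]
-- over k free number variables (de Bruijn) and one free string variable X.

data Term (k : ℕ) : Set where
  var  : Fin k → Term k
  `0   : Term k
  `1   : Term k
  _⊕_  : Term k → Term k → Term k
  _⊗_  : Term k → Term k → Term k
  ∣X∣  : Term k

data Form (k : ℕ) : Set where
  mem  : Term k → Form k
  eq   : Term k → Term k → Form k
  leq  : Term k → Term k → Form k
  neg  : Form k → Form k
  conj : Form k → Form k → Form k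
  disj : Form k → Form k → Form k
  exB  : Term k → Form (suc k) → Form k
  allB : Term k → Form (suc k) → Form k

evalT : ∀ {k} → Term k → Vec ℕ k → Str → ℕ
evalT (var i) ρ X = vlookup ρ i
evalT `0      ρ X = 0
evalT `1      ρ X = 1
evalT (t ⊕ u) ρ X = evalT t ρ X + evalT u ρ X
evalT (t ⊗ u) ρ X = evalT t ρ X * evalT u ρ X
evalT ∣X∣     ρ X = length X

evalF : ∀ {k} → Form k → Vec ℕ k → Str → Bool
evalF (mem t)    ρ X = bit X (evalT t ρ X)
evalF (eq t u)   ρ X = evalT t ρ X ≡ᵇ evalT u ρ X
evalF (leq t u)  ρ X = evalT t ρ X ≤ᵇ evalT u ρ X
evalF (neg φ)    ρ X = not (evalF φ ρ X)
evalF (conj φ ψ) ρ X = evalF φ ρ X ∧ evalF ψ ρ X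
evalF (disj φ ψ) ρ X = evalF φ ρ X ∨ evalF ψ ρ X
evalF (exB t φ)  ρ X = any (λ x → evalF φ (x Data.Vec.∷ ρ) X) (upTo (suc (evalT t ρ X)))
evalF (allB t φ) ρ X = all (λ x → evalF φ (x Data.Vec.∷ ρ) X) (upTo (suc (evalT t ρ X)))

-- Uniform AC^0 (FAC^0) string functions, as in Cook–Nguyen:
-- polynomially bounded length, Σ^B_0-definable length and bit graph.

record IsAC0 (F : Str → Str) : Set where
  field
    bound     : Term 0
    bounded   : ∀ X → length (F X) ≤ evalT bound Data.Vec.[] X
    lenDef    : Form 1
    lenDefOK  : ∀ X y → (evalF lenDef (y Data.Vec.∷ Data.Vec.[]) X ≡ true) ⇔ (y ≡ length (F X))
    bitDef    : Form 1
    bitDefOK  : ∀ X i → i < length (F X) → bit (F X) i ≡ evalF bitDef (i Data.Vec.∷ Data.Vec.[]) X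

_≤AC0_ : (Str → Set) → (Str → Set) → Set
A ≤AC0 B = Σ (Str → Str) λ F → IsAC0 F × (∀ X → A X ⇔ B (F X))

unary : ℕ → Str
unary k = replicate k true ++ (false ∷ [])

eqFin : ∀ {n} → Fin n → Fin n → Bool
eqFin i j = ⌊ i ≟ j ⌋

oneHot : (n : ℕ) → Fin n → Str
oneHot n i = L.tabulate (λ k → eqFin k i)

enc3 : (n : ℕ) → (Fin n → Fin n → Fin n → Bool) → Str
enc3 n p = concat (L.tabulate λ a → concat (L.tabulate λ b → L.tabulate λ c → p a b c))

-- Stable marriage.  Men and women are both indexed by Fin n.
-- mp m w w' = true  iff man m strictly prefers woman w to woman w';
-- wp w m m' = true  iff woman w strictly prefers man m to man m'.

Pref : ℕ → Set
Pref n = Fin n → Fin n → Fin n → Bool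

StrictTotalRows : ∀ {n} → Pref n → Set
StrictTotalRows {n} p =
  (∀ a x → p a x x ≡ false) ×
  (∀ a x y z → p a x y ≡ true → p a y z ≡ true → p a x z ≡ true) ×
  (∀ a x y → x ≢ y → p a x y ≡ true ⊎ p a y x ≡ true)

-- a marriage: μ m is the wife of man m (a bijection Fin n → Fin n)
Marriage : ℕ → Set
Marriage n = Fin n → Fin n

Blocks : ∀ {n} → Pref n → Pref n → Marriage n → Fin n → Fin n → Set
Blocks mp wp μ m w = mp m w (μ m) ≡ true × ∃[ m' ] (μ m' ≡ w × wp w m m' ≡ true)

Stable : ∀ {n} → Pref n → Pref n → Marriage n → Set
Stable mp wp μ = Injective _≡_ _≡_ μ × (∀ m w → ¬ Blocks mp wp μ m w)

ManOptimal : ∀ {n} → Pref n → Pref n → Marriage n → Set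
ManOptimal mp wp μ = Stable mp wp μ ×
  (∀ ν → Stable mp wp ν → ∀ m → μ m ≡ ν m ⊎ mp m (μ m) (ν m) ≡ true)

WomanOptimal : ∀ {n} → Pref n → Pref n → Marriage n → Set
WomanOptimal mp wp μ = Stable mp wp μ ×
  (∀ ν → Stable mp wp ν → ∀ m m' → μ m ≡ ν m' → m ≡ m' ⊎ wp (μ m) m m' ≡ true)

encSM : (n : ℕ) → Fin n → Fin n → Pref n → Pref n → Str
encSM n a b mp wp = unary n ++ unary (toℕ a) ++ unary (toℕ b) ++ enc3 n mp ++ enc3 n wp

MoSm : Str → Set
MoSm X = ∃[ n ] Σ (Fin n) λ a → Σ (Fin n) λ b → Σ (Pref n) λ mp → Σ (Pref n) λ wp →
  X ≡ encSM n a b mp wp × StrictTotalRows mp × StrictTotalRows wp ×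
  ∃[ μ ] (ManOptimal mp wp μ × μ a ≡ b)

WoSm : Str → Set
WoSm X = ∃[ n ] Σ (Fin n) λ a → Σ (Fin n) λ b → Σ (Pref n) λ mp → Σ (Pref n) λ wp →
  X ≡ encSM n a b mp wp × StrictTotalRows mp × StrictTotalRows wp ×
  ∃[ μ ] (WomanOptimal mp wp μ × μ a ≡ b)

data Gate (n : ℕ) : Set where
  cmp : Fin n → Fin n → Gate n
  ngt : Fin n → Gate n

applyGate : ∀ {n} → Vec Bool n → Gate n → Vec Bool n
applyGate v (cmp i j) =
  let p = vlookup v i ; q = vlookup v j in
  ((v [ i ]≔ (p ∧ q)) [ j ]≔ (p ∨ q))
applyGate v (ngt i) = v [ i ]≔ not (vlookup v i)

runCircuit : ∀ {n} → List (Gate n) → Vec Bool n → Vec Bool n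
runCircuit gs v = foldl applyGate v gs

-- gate encoding (fixed width 1 + 2n): type bit, one-hot first wire, one-hot second wire (zeros for negation)
encGate : ∀ {n} → Gate n → Str
encGate {n} (cmp i j) = false ∷ oneHot n i ++ oneHot n j
encGate {n} (ngt i)   = true ∷ oneHot n i ++ replicate n false

encCcv : (n : ℕ) → Fin n → Vec Bool n → List (Gate n) → Str
encCcv n d inp gs = unary n ++ unary (toℕ d) ++ vtoList inp ++ concatMap encGate gs

CcvNeg : Str → Set
CcvNeg X = ∃[ n ] Σ (Fin n) λ d → Σ (Vec Bool n) λ inp → Σ (List (Gate n)) λ gs →
  X ≡ encCcv n d inp gs × vlookup (runCircuit gs inp) d ≡ true

{-# OPTIONS --safe #-}
module Submission where

-- A comparator maps (p , t) to (p ∧ t , p ∨ t).  Read p as "m has been turned down by every woman he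
-- prefers to w" and t as "w has received a proposal from a man she prefers to m".  Then p ∧ t is the value
-- of p for m and his next choice after w, and p ∨ t is the value of t for w and her next choice after m.
-- Hence one round of deferred acceptance is one comparator per pair (m , w), followed by moving both outputs
-- one place down the preference lists; no value is used twice, so comparators suffice.  Iterated from "no
-- proposals", the 2n² values only increase, so they are constant after 2n² rounds.  The pair (m , w) is
-- married in the man-optimal marriage iff then p holds and t does not, which is where a negation is needed.
-- Exchanging the two sexes gives the woman-optimal marriage.
--
-- Ranks in a preference list are not AC⁰ computable, but immediate successors are Σ^B_0 definable.  So every
-- round gets fresh wires, and each triple (m , w , w') contributes a gate that moves a value if w' follows w
-- in the list of m and is idle otherwise.

open import Defs
open import Data.Bool using (Bool; true; false; _∧_; _∨_; not; if_then_else_)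
open import Data.Bool.ListAction using (any; and; or)
open import Data.Bool.Properties using (∨-idem; ∨-identityʳ; ¬-not; not-¬) renaming (_≟_ to _≟ᵇ_)
open import Data.Empty using (⊥; ⊥-elim)
open import Data.Fin using (Fin; zero; suc; toℕ; fromℕ; fromℕ<; inject₁; combine; remQuot; lift; _↑ˡ_) renaming (_≟_ to _≟F_)
open import Data.Fin.Induction using (spo-wellFounded)
open import Data.Fin.Properties using (any?; all?; pigeonhole; ¬∀⟶∃¬; remQuot-combine; combine-injective; toℕ-combine; punchOut-injective; <⇒notInjective; 0≢1+n; toℕ<n; toℕ-fromℕ; toℕ-fromℕ<; toℕ-inject₁; toℕ-injective) renaming (suc-injective to sucF-injective)
open import Data.List using (List; []; _∷_; _++_; length; concat; concatMap; tabulate; replicate; applyUpTo; upTo)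
open import Data.List.Properties using (foldl-++; map-cong; length-++; length-tabulate; length-replicate; concatMap-++; ++-identityʳ; tabulate-cong; ∷-injective)
open import Data.Nat using (ℕ; zero; suc; _+_; _*_; _∸_; _≤_; _<_; z≤n; s≤s; _≟_; _<?_; NonZero; >-nonZero; _≤ᵇ_; _≡ᵇ_)
open import Data.Nat.DivMod using (_/_; _%_; m≡m%n+[m/n]*n; m%n<n; m%n≤m; m/n≤m; m<n*o⇒m/o<n)
open import Data.Nat.Properties using (n<1+n; n≤1+n; ≤-refl; ≤-reflexive; ≤-trans; ≤-pred; ≤-<-trans; <-irrefl; <⇒≤; ≮⇒≥; ≤ᵇ-reflects-≤; suc-injective; +-comm; +-assoc; +-mono-≤; +-monoʳ-<; +-cancelˡ-<; *-mono-≤; *-monoˡ-≤; *-cancelʳ-<; m≤m+n; m∸n≤m; m∸n+n≡m; m+[n∸m]≡n; m*n≢0⇒n≢0)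
open import Data.Product using (Σ; ∃; ∃-syntax; _×_; _,_; proj₁; proj₂; map₂)
open import Data.Sum using (_⊎_; inj₁; inj₂)
import Data.Sum as Sum
open import Data.Vec using (Vec; []; _∷_; _[_]≔_) renaming (lookup to vlookup; _++_ to _++ᵛ_; toList to vtoList)
import Data.Vec as V
open import Data.Vec.Properties using (lookup∘update; lookup∘update′; lookup-replicate; toList-replicate; length-toList; toList-injective; cast-is-id)
open import Function using (_∘_; id)
open import Function.Bundles using (_⇔_; mk⇔; Equivalence)
open import Function.Definitions using (Injective)
open import Induction.WellFounded using (Acc; acc; WellFounded)
open import Relation.Binary.PropositionalEquality
open import Relation.Nullary using (¬_; Dec; yes; no; does; proof; Reflects; ofʸ; ofⁿ; ¬?)
open import Relation.Nullary.Decidable using (_×-dec_; _⊎-dec_; _→-dec_; decidable-stable; isYes≗does; map′)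
open import Relation.Nullary.Reflects using (_×-reflects_; _⊎-reflects_; _→-reflects_; ¬-reflects; det)
open import Relation.Unary using (Decidable)

-- The gate list has to be written down by formulas that cannot count ranks, so the number and the
-- order of the gates depend on `n` alone; the preferences only select the second wire or the type
-- of a gate. A comparator with both ends on one wire is the idle gate, since its second write
-- stores p ∨ p. Because all gates have the same width, finding the bit at a given position means
-- dividing with remainder by known widths, which bounded quantifiers can do. All inputs of the
-- circuit are 0: the proposals to first choices, the only values not obtained from an earlier
-- round, come from negating a blank wire. The reduction must also answer on malformed strings. It
-- returns the empty string there, which encodes no circuit. On the other strings `n` and the
-- designated pair are guessed by bounded quantifiers, which is harmless because the unary header
-- fixes them. The preferences are too large to be guessed by number variables; they are read at the
-- positions that these numbers determine.

private
  variable
    k l m n N : ℕ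

-- Deferred acceptance

-- Punching out a missed value would give an injection of `Fin (suc n)` into `Fin n`.
injective⇒surjective : ∀ {n} {f : Fin n → Fin n} → Injective _≡_ _≡_ f → ∀ y → ∃ λ x → f x ≡ y
injective⇒surjective {suc n} {f} inj y with any? (λ x → f x ≟F y)
... | yes found = found
... | no missed = ⊥-elim (<⇒notInjective (n<1+n n)
        (λ e → inj (punchOut-injective (avoids _) (avoids _) e)))
  where
  avoids : ∀ x → y ≢ f x
  avoids x e = missed (x , sym e)

-- Increasing chains of subsets of a finite set

module _ {M : ℕ} (Q : ℕ → Fin M → Set) (Q? : ∀ k → Decidable (Q k))
         (Q-mono : ∀ k i → Q k i → Q (suc k) i) where

  private
    mono-≤ : ∀ d k i → Q k i → Q (d + k) i
    mono-≤ zero    k i q = q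
    mono-≤ (suc d) k i q = Q-mono (d + k) i (mono-≤ d k i q)

    mono-< : ∀ {j k} i → j < k → Q (suc j) i → Q k i
    mono-< {j} {k} i j<k q = subst (λ l → Q l i) (m∸n+n≡m j<k) (mono-≤ (k ∸ suc j) (suc j) i q)

  -- Otherwise each of the M + 1 steps would turn on a new index.
  chain-stabilises : (∀ k → (∀ i → Q (suc k) i → Q k i) → ∀ i → Q (2 + k) i → Q (suc k) i) →
                     ∀ i → Q (suc M) i → Q M i
  chain-stabilises persists = at-end
    where
    still? : ∀ k → Dec (∀ i → Q (suc k) i → Q k i)
    still? k = all? (λ i → Q? (suc k) i →-dec Q? k i)

    stable-from : ∀ d k → (∀ i → Q (suc k) i → Q k i) → ∀ i → Q (suc (d + k)) i → Q (d + k) i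
    stable-from zero    k st = st
    stable-from (suc d) k st = persists (d + k) (stable-from d k st)

    new : (k : ℕ) → ¬ (∀ i → Q (suc k) i → Q k i) → ∃ λ i → Q (suc k) i × ¬ Q k i
    new k moved with ¬∀⟶∃¬ M _ (λ i → Q? (suc k) i →-dec Q? k i) moved
    ... | i , ¬imp = i , decidable-stable (Q? (suc k) i) (λ ¬q → ¬imp (λ q → ⊥-elim (¬q q))) , λ q → ¬imp (λ _ → q)

    at-end : ∀ i → Q (suc M) i → Q M i
    at-end with any? {n = suc M} (λ k → still? (toℕ k))
    ... | yes (k , st) = subst (λ l → ∀ i → Q (suc l) i → Q l i) (m∸n+n≡m (≤-pred (toℕ<n k)))
                           (stable-from (M ∸ toℕ k) (toℕ k) st)
    ... | no never with pigeonhole (n<1+n M) (λ k → proj₁ (new (toℕ k) (λ st → never (k , st))))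
    ...   | j , k , j<k , same =
            let (i , q , _) = new (toℕ j) (λ st → never (j , st))
                (_ , _ , ¬q) = new (toℕ k) (λ st → never (k , st))
            in ⊥-elim (¬q (subst (Q (toℕ k)) same (mono-< i j<k q)))

-- First choices and immediate successors in preference lists

First : ∀ {n} → Pref n → Fin n → Fin n → Set
First p a x = ∀ z → ¬ (p a z x ≡ true)

Next : ∀ {n} → Pref n → Fin n → Fin n → Fin n → Set
Next p a x y = p a x y ≡ true × (∀ z → ¬ (p a x z ≡ true × p a z y ≡ true))

first? : ∀ {n} (p : Pref n) a x → Dec (First p a x)
first? p a x = all? (λ z → ¬? (p a z x ≟ᵇ true))

next? : ∀ {n} (p : Pref n) a x y → Dec (Next p a x y)
next? p a x y = (p a x y ≟ᵇ true) ×-dec all? (λ z → ¬? ((p a x z ≟ᵇ true) ×-dec (p a z y ≟ᵇ true)))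

module Rows {n} {p : Pref n} (strict : StrictTotalRows p) where

  ≻-irrefl : ∀ {a x} → ¬ (p a x x ≡ true)
  ≻-irrefl {a} {x} e with () ← trans (sym e) (proj₁ strict a x)

  ≻-trans : ∀ {a x y z} → p a x y ≡ true → p a y z ≡ true → p a x z ≡ true
  ≻-trans {a} {x} {y} {z} = proj₁ (proj₂ strict) a x y z

  ≻-asym : ∀ {a x y} → p a x y ≡ true → ¬ (p a y x ≡ true)
  ≻-asym e e' = ≻-irrefl (≻-trans e e')

  compare : ∀ a x y → x ≡ y ⊎ p a x y ≡ true ⊎ p a y x ≡ true
  compare a x y with x ≟F y
  ... | yes e = inj₁ e
  ... | no ne = inj₂ (proj₂ (proj₂ strict) a x y ne)

  next-uniqueˡ : ∀ {a x x' y} → Next p a x y → Next p a x' y → x ≡ x'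
  next-uniqueˡ {a} {x} {x'} (xy , gap) (x'y , gap') with compare a x x'
  ... | inj₁ e        = e
  ... | inj₂ (inj₁ e) = ⊥-elim (gap x' (e , x'y))
  ... | inj₂ (inj₂ e) = ⊥-elim (gap' x (e , xy))

  next-uniqueʳ : ∀ {a x y y'} → Next p a x y → Next p a x y' → y ≡ y'
  next-uniqueʳ {a} {x} {y} {y'} (xy , gap) (xy' , gap') with compare a y y'
  ... | inj₁ e        = e
  ... | inj₂ (inj₁ e) = ⊥-elim (gap' y (xy , e))
  ... | inj₂ (inj₂ e) = ⊥-elim (gap y' (xy' , e))

  -- A finite strict order is well founded in both directions. This direction lets an induction
  -- climb to more preferred persons, the next one lets it descend to less preferred ones.
  ≻-wellFounded : ∀ a → WellFounded (λ x y → p a x y ≡ true)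
  ≻-wellFounded a = spo-wellFounded record
    { isEquivalence = isEquivalence
    ; irrefl = λ { refl → ≻-irrefl }
    ; trans = ≻-trans
    ; <-resp-≈ = (λ { refl e → e }) , (λ { refl e → e }) }

  ≺-wellFounded : ∀ a → WellFounded (λ x y → p a y x ≡ true)
  ≺-wellFounded a = spo-wellFounded record
    { isEquivalence = isEquivalence
    ; irrefl = λ { refl → ≻-irrefl }
    ; trans = λ e e' → ≻-trans e' e
    ; <-resp-≈ = (λ { refl e → e }) , (λ { refl e → e }) }

  -- From `z`, descend while somebody lies strictly between the current person and `y`; the descent
  -- ends at the immediate predecessor of `y`.
  predecessor : ∀ a {z y} → p a z y ≡ true → ∃ λ x → Next p a x y × (z ≡ x ⊎ p a z x ≡ true)
  predecessor a {z} {y} zy = go (≺-wellFounded a z) zy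
    where
    go : ∀ {z} → Acc (λ x y → p a y x ≡ true) z → p a z y ≡ true →
         ∃ λ x → Next p a x y × (z ≡ x ⊎ p a z x ≡ true)
    go {z} (acc rec) zy with any? (λ v → (p a z v ≟ᵇ true) ×-dec (p a v y ≟ᵇ true))
    ... | no gap = z , (zy , λ v e → gap (v , e)) , inj₁ refl
    ... | yes (v , zv , vy) with go (rec zv) vy
    ...   | x , nx , inj₁ refl = x , nx , inj₂ zv
    ...   | x , nx , inj₂ vx   = x , nx , inj₂ (≻-trans zv vx)

-- The rounds, their fixed point and the man-optimal marriage

module DeferredAcceptance {n} (mp wp : Pref n) where

  mutual
    -- P k m w: within k rounds m has been turned down by every woman he prefers to w;
    -- T k w m: within k rounds a man whom w prefers to m has proposed to w.
    P : ℕ → Fin n → Fin n → Set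
    P zero    m w = ⊥
    P (suc k) m w = First mp m w ⊎ ∃ λ v → Next mp m v w × P k m v × T k v m

    T : ℕ → Fin n → Fin n → Set
    T zero    w m = ⊥
    T (suc k) w m = ∃ λ l → Next wp w l m × (P k l w ⊎ T k w l)

  mutual
    P? : ∀ k m w → Dec (P k m w)
    P? zero    m w = no λ ()
    P? (suc k) m w = first? mp m w ⊎-dec any? (λ v → next? mp m v w ×-dec P? k m v ×-dec T? k v m)

    T? : ∀ k w m → Dec (T k w m)
    T? zero    w m = no λ ()
    T? (suc k) w m = any? (λ l → next? wp w l m ×-dec (P? k l w ⊎-dec T? k w l))

  -- A round is a monotone operator on the pair of relations. Applied with `k'` one above `k` this
  -- makes the relations grow; applied with `k'` one below `k` it shows that a round without change
  -- is followed by another one.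
  module _ {k k'} (P⊆ : ∀ m w → P k m w → P k' m w) (T⊆ : ∀ w m → T k w m → T k' w m) where
    P-step : ∀ m w → P (suc k) m w → P (suc k') m w
    P-step m w (inj₁ f)                 = inj₁ f
    P-step m w (inj₂ (v , nx , p , t)) = inj₂ (v , nx , P⊆ m v p , T⊆ v m t)

    T-step : ∀ w m → T (suc k) w m → T (suc k') w m
    T-step w m (l , nx , inj₁ p) = l , nx , inj₁ (P⊆ l w p)
    T-step w m (l , nx , inj₂ t) = l , nx , inj₂ (T⊆ w l t)

  mutual
    P-mono : ∀ k m w → P k m w → P (suc k) m w
    P-mono (suc k) = P-step (P-mono k) (T-mono k)

    T-mono : ∀ k w m → T k w m → T (suc k) w m
    T-mono (suc k) = T-step (P-mono k) (T-mono k)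

  rounds : ℕ
  rounds = 2 * (n * n)

  private
    At : ℕ → Fin 2 × Fin n × Fin n → Set
    At k (zero  , x , y) = P k x y
    At k (suc _ , x , y) = T k x y

    At? : ∀ k i → Dec (At k i)
    At? k (zero  , x , y) = P? k x y
    At? k (suc _ , x , y) = T? k x y

    At-mono : ∀ k i → At k i → At (suc k) i
    At-mono k (zero  , x , y) = P-mono k x y
    At-mono k (suc _ , x , y) = T-mono k x y

    decode : Fin rounds → Fin 2 × Fin n × Fin n
    decode i = map₂ (remQuot {n} n) (remQuot {2} (n * n) i)

    encode : Fin 2 × Fin n × Fin n → Fin rounds
    encode (s , x , y) = combine s (combine x y)

    decode-encode : ∀ i → decode (encode i) ≡ i
    decode-encode (s , x , y) = trans
      (cong (map₂ (remQuot {n} n)) (remQuot-combine {2} {n * n} s (combine x y)))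
      (cong (s ,_) (remQuot-combine {n} {n} x y))

    persists : ∀ k → (∀ i → At (suc k) (decode i) → At k (decode i)) →
               ∀ i → At (2 + k) (decode i) → At (suc k) (decode i)
    persists k st i = go (decode i)
      where
      back : ∀ i → At (suc k) i → At k i
      back i q = subst (At k) (decode-encode i) (st (encode i) (subst (At (suc k)) (sym (decode-encode i)) q))
      go : ∀ i → At (2 + k) i → At (suc k) i
      go (zero  , x , y) = P-step (λ m w → back (zero , m , w)) (λ w m → back (suc zero , w , m)) x y
      go (suc _ , x , y) = T-step (λ m w → back (zero , m , w)) (λ w m → back (suc zero , w , m)) x y

    fixed : ∀ i → At (suc rounds) i → At rounds i
    fixed i q = subst (At rounds) (decode-encode i)
      (chain-stabilises (λ k i → At k (decode i)) (λ k i → At? k (decode i)) (λ k i → At-mono k (decode i))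
        persists (encode i) (subst (At (suc rounds)) (sym (decode-encode i)) q))

  P-fixed : ∀ m w → P (suc rounds) m w → P rounds m w
  P-fixed m w = fixed (zero , m , w)

  T-fixed : ∀ w m → T (suc rounds) w m → T rounds w m
  T-fixed w m = fixed (suc zero , w , m)

  Matched : Fin n → Fin n → Set
  Matched m w = P rounds m w × ¬ T rounds w m

  module _ (mp-strict : StrictTotalRows mp) (wp-strict : StrictTotalRows wp) where
    private
      module M = Rows mp-strict
      module W = Rows wp-strict
      K = rounds

    -- A proposal to `w` was triggered by a rejection from her immediate predecessor `u`. As nobody
    -- lies between, `v` is `u` or ranks above `u`, and then the induction applies to the proposal
    -- to `u`.
    proposed⇒rejected : ∀ k {m v w} → P k m w → mp m v w ≡ true → P k m v × T k v m
    proposed⇒rejected (suc k) {m} {v} {w} (inj₁ f) vw = ⊥-elim (f v vw)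
    proposed⇒rejected (suc k) {m} {v} {w} (inj₂ (u , (uw , gap) , p , t)) vw with M.compare m v u
    ... | inj₁ refl      = P-mono k m v p , T-mono k v m t
    ... | inj₂ (inj₂ uv) = ⊥-elim (gap v (uv , vw))
    ... | inj₂ (inj₁ vu) with proposed⇒rejected k p vu
    ...   | p' , t' = P-mono k m v p' , T-mono k v m t'

    -- `T` creeps down the list of `w` one place per round; unwinding it leads back to the man whose
    -- proposal started it.
    rejected⇒better : ∀ k {w m} → T k w m → ∃ λ l → P k l w × wp w l m ≡ true
    rejected⇒better (suc k) {w} {m} (l , (lm , _) , inj₁ p) = l , P-mono k l w p , lm
    rejected⇒better (suc k) {w} {m} (l , (lm , _) , inj₂ t) with rejected⇒better k t
    ... | l' , p , l'l = l' , P-mono k l' w p , W.≻-trans l'l lm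

    -- Carrying the news of a proposal down the list of `w` costs one round per place. At the fixed
    -- point these extra rounds are free, so the induction follows the list instead of the rounds.
    better⇒rejected : ∀ {w m l} → P K l w → wp w l m ≡ true → T K w m
    better⇒rejected {w} {m} {l} p lm = go (W.≻-wellFounded w m) lm
      where
      go : ∀ {m} → Acc (λ x y → wp w x y ≡ true) m → wp w l m ≡ true → T K w m
      go {m} (acc rec) lm with W.predecessor w lm
      ... | x , nx , inj₁ refl = T-fixed w m (x , nx , inj₁ p)
      ... | x , nx , inj₂ lx   = T-fixed w m (x , nx , inj₂ (go (rec (proj₁ nx)) lx))

    -- Climb the list of `w`: a suitor who has been turned down was beaten by a better suitor, and
    -- the best one is kept.
    proposed⇒engaged : ∀ {m w} → P K m w → ∃ λ l → Matched l w × (l ≡ m ⊎ wp w l m ≡ true)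
    proposed⇒engaged {m} {w} p = go (W.≻-wellFounded w m) p
      where
      go : ∀ {m} → Acc (λ x y → wp w x y ≡ true) m → P K m w → ∃ λ l → Matched l w × (l ≡ m ⊎ wp w l m ≡ true)
      go {m} (acc rec) p with T? K w m
      ... | no ¬t = m , (p , ¬t) , inj₁ refl
      ... | yes t with rejected⇒better K t
      ...   | l , p' , lm with go (rec lm) p'
      ...     | l' , mt , inj₁ refl = l' , mt , inj₂ lm
      ...     | l' , mt , inj₂ l'l  = l' , mt , inj₂ (W.≻-trans l'l lm)

    matched-functional : ∀ {m v w} → Matched m v → Matched m w → v ≡ w
    matched-functional {m} {v} {w} (p , ¬t) (p' , ¬t') with M.compare m v w
    ... | inj₁ e         = e
    ... | inj₂ (inj₁ vw) = ⊥-elim (¬t (proj₂ (proposed⇒rejected K p' vw)))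
    ... | inj₂ (inj₂ wv) = ⊥-elim (¬t' (proj₂ (proposed⇒rejected K p wv)))

    matched-injective : ∀ {m l w} → Matched m w → Matched l w → m ≡ l
    matched-injective {m} {l} {w} (p , ¬t) (p' , ¬t') with W.compare w m l
    ... | inj₁ e         = e
    ... | inj₂ (inj₁ ml) = ⊥-elim (¬t' (better⇒rejected p ml))
    ... | inj₂ (inj₂ lm) = ⊥-elim (¬t (better⇒rejected p' lm))

    -- A man rejected by every woman would leave n engaged women to the other n - 1 men.
    matched-total : ∀ m → ∃ λ w → Matched m w
    matched-total m with any? (λ w → P? K m w ×-dec ¬? (T? K w m))
    ... | yes found = found
    ... | no single = ⊥-elim (single (contra (injective⇒surjective husband-inj m)))
      where
      -- An unmatched man is turned down wherever he proposes, so at the fixed point his proposals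
      -- run through his whole list. Hence every woman has a suitor, and therefore a husband.
      proposes : ∀ {w} → Acc (λ x y → mp m x y ≡ true) w → P K m w
      proposes {w} (acc rec) with any? (λ v → mp m v w ≟ᵇ true)
      ... | no f = P-fixed m w (inj₁ (λ z e → f (z , e)))
      ... | yes (v , vw) with M.predecessor m vw
      ...   | x , nx , _ = P-fixed m w (inj₂ (x , nx , p , decidable-stable (T? K x m) (λ ¬t → single (x , p , ¬t))))
        where p = proposes (rec (proj₁ nx))

      engaged : ∀ w → ∃ λ l → Matched l w
      engaged w with proposed⇒engaged (proposes (M.≻-wellFounded m w))
      ... | l , mt , _ = l , mt

      husband : Fin n → Fin n
      husband w = proj₁ (engaged w)

      husband-inj : Injective _≡_ _≡_ husband
      husband-inj {v} {w} e = matched-functional (subst (λ l → Matched l v) e (proj₂ (engaged v))) (proj₂ (engaged w))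

      contra : ∃ (λ w → husband w ≡ m) → ∃ λ w → Matched m w
      contra (w , e) = w , subst (λ l → Matched l w) e (proj₂ (engaged w))

    μ : Marriage n
    μ m = proj₁ (matched-total m)

    μ-matched : ∀ m → Matched m (μ m)
    μ-matched m = proj₂ (matched-total m)

    -- The man of a blocking pair proposed to the woman on his way down to `μ m`. By the fixed point
    -- that proposal has displaced the husband whom she likes less.
    μ-stable : Stable mp wp μ
    μ-stable = inj , unblocked
      where
      inj : Injective _≡_ _≡_ μ
      inj {m} {l} e = matched-injective (μ-matched m) (subst (Matched l) (sym e) (μ-matched l))

      unblocked : ∀ m w → ¬ Blocks mp wp μ m w
      unblocked m w (better , l , refl , ml)
        with proposed⇒rejected K (proj₁ (μ-matched m)) better
      ... | p , _ = proj₂ (μ-matched l) (better⇒rejected p ml)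

    -- The rounds stay below the fixed point in which every man has proposed exactly down to ν m.
    module _ {ν : Marriage n} (ν-stable : Stable mp wp ν) where
      private
        -- The place where stability of `ν` enters: if `w` preferred `m` to her husband in `ν`, the
        -- two would block `ν`.
        partner-preferred : ∀ {m w} → mp m w (ν m) ≡ true → ∃ λ l → ν l ≡ w × wp w l m ≡ true
        partner-preferred {m} {w} better with injective⇒surjective (proj₁ ν-stable) w
        ... | l , refl with W.compare w l m
        ...   | inj₁ refl      = ⊥-elim (M.≻-irrefl better)
        ...   | inj₂ (inj₁ lm) = l , refl , lm
        ...   | inj₂ (inj₂ ml) = ⊥-elim (proj₂ ν-stable m w (better , l , refl , ml))

      mutual
        proposals-above : ∀ k {m w} → P k m w → w ≡ ν m ⊎ mp m w (ν m) ≡ true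
        proposals-above (suc k) {m} {w} (inj₁ f) with M.compare m w (ν m)
        ... | inj₁ e        = inj₁ e
        ... | inj₂ (inj₁ e) = inj₂ e
        ... | inj₂ (inj₂ e) = ⊥-elim (f (ν m) e)
        proposals-above (suc k) {m} {w} (inj₂ (v , (vw , gap) , p , t))
          with rejections-below k t | proposals-above k p
        -- A rejection of `m` by `ν m` would need a man whom she prefers to `m` and who is her
        -- husband in `ν`; but that husband is `m`.
        ... | l , e , lm | inj₁ refl with refl ← proj₁ ν-stable e = ⊥-elim (W.≻-irrefl lm)
        ... | _ | inj₂ vν with M.compare m w (ν m)
        ...   | inj₁ e        = inj₁ e
        ...   | inj₂ (inj₁ e) = inj₂ e
        ...   | inj₂ (inj₂ e) = ⊥-elim (gap (ν m) (vν , e))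

        rejections-below : ∀ k {w m} → T k w m → ∃ λ l → ν l ≡ w × wp w l m ≡ true
        rejections-below (suc k) {w} {m} (l , (lm , _) , inj₂ t) with rejections-below k t
        ... | l' , e , l'l = l' , e , W.≻-trans l'l lm
        rejections-below (suc k) {w} {m} (l , (lm , _) , inj₁ p) with proposals-above k p
        ... | inj₁ e = l , sym e , lm
        ... | inj₂ better with partner-preferred better
        ...   | l' , e , l'l = l' , e , W.≻-trans l'l lm

    μ-optimal : ManOptimal mp wp μ
    μ-optimal = μ-stable , λ ν st m → proposals-above st rounds (proj₁ (μ-matched m))

    -- Of two man-optimal marriages each is at least as good as the other for every man, so by
    -- asymmetry they agree. Hence the computed `μ` settles the question for every candidate.
    matched⇔optimal : ∀ a b → (Matched a b → ∃[ ν ] (ManOptimal mp wp ν × ν a ≡ b)) ×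
                              (∃[ ν ] (ManOptimal mp wp ν × ν a ≡ b) → Matched a b)
    matched⇔optimal a b = to , from
      where
      to : Matched a b → ∃[ ν ] (ManOptimal mp wp ν × ν a ≡ b)
      to mt = μ , μ-optimal , matched-functional (μ-matched a) mt
      from : ∃[ ν ] (ManOptimal mp wp ν × ν a ≡ b) → Matched a b
      from (ν , (ν-st , ν-opt) , refl) with ν-opt μ μ-stable a | proj₂ μ-optimal ν ν-st a
      ... | inj₁ e | _      = subst (Matched a) (sym e) (μ-matched a)
      ... | inj₂ _ | inj₁ e = subst (Matched a) e (μ-matched a)
      ... | inj₂ e | inj₂ e' = ⊥-elim (M.≻-asym e e')

-- Exchanging the two sexes

module _ {n} {mp wp : Pref n} {μ ν : Marriage n} (νμ : ∀ m → ν (μ m) ≡ m) (μν : ∀ w → μ (ν w) ≡ w) where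

  -- Inverting a marriage merely swaps the two conditions on a blocking pair; the husband of `w`
  -- that `Blocks` asks for is `ν w`.
  stable-inverse : Stable mp wp μ → Stable wp mp ν
  stable-inverse (_ , unblocked) =
    (λ {v} {w} e → trans (sym (μν v)) (trans (cong μ e) (μν w))) ,
    λ { w m (better , v , refl , e) →
        unblocked m w (subst (λ u → mp m w u ≡ true) (sym (μν v)) e , ν w , μν w , better) }

inverse : ∀ {n} {μ : Marriage n} → Injective _≡_ _≡_ μ →
          Σ (Marriage n) λ ν → (∀ m → ν (μ m) ≡ m) × (∀ w → μ (ν w) ≡ w)
inverse {μ = μ} inj = ν , (λ m → inj (μν (μ m))) , μν
  where
  ν = λ w → proj₁ (injective⇒surjective inj w)
  μν = λ w → proj₂ (injective⇒surjective inj w)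

-- The competitors have to be inverted as well. Woman-optimality compares two men with the same wife
-- in two marriages; for the woman `w` these men are `ν w` and `ξ w`.
womanOptimal⇒swapped : ∀ {n} {mp wp : Pref n} {a b} →
  ∃[ μ ] (WomanOptimal mp wp μ × μ a ≡ b) → ∃[ ν ] (ManOptimal wp mp ν × ν b ≡ a)
womanOptimal⇒swapped {n} {mp} {wp} {a} {b} (μ , (st , opt) , refl) with inverse (proj₁ st)
... | ν , νμ , μν = ν , (stable-inverse νμ μν st , best) , νμ a
  where
  best : ∀ ξ → Stable wp mp ξ → ∀ w → ν w ≡ ξ w ⊎ wp w (ν w) (ξ w) ≡ true
  best ξ ξ-st w with inverse (proj₁ ξ-st)
  ... | ζ , ζξ , ξζ with opt ζ (stable-inverse ζξ ξζ ξ-st) (ν w) (ξ w) (trans (μν w) (sym (ζξ w)))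
  ...   | inj₁ e = inj₁ e
  ...   | inj₂ e = inj₂ (subst (λ v → wp v (ν w) (ξ w) ≡ true) (μν w) e)

swapped⇒womanOptimal : ∀ {n} {mp wp : Pref n} {a b} →
  ∃[ ν ] (ManOptimal wp mp ν × ν b ≡ a) → ∃[ μ ] (WomanOptimal mp wp μ × μ a ≡ b)
swapped⇒womanOptimal {n} {mp} {wp} {a} {b} (ν , (st , opt) , refl) with inverse (proj₁ st)
... | μ , μν , νμ = μ , (stable-inverse μν νμ st , best) , μν b
  where
  best : ∀ ξ → Stable mp wp ξ → ∀ m m' → μ m ≡ ξ m' → m ≡ m' ⊎ wp (μ m) m m' ≡ true
  best ξ ξ-st m m' e with inverse (proj₁ ξ-st)
  ... | ζ , ζξ , ξζ with opt ζ (stable-inverse ζξ ξζ ξ-st) (μ m)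
  ...   | r rewrite νμ m | e | ζξ m' = r

-- The comparator network

reflects-map : ∀ {A B : Set} {b} → (A → B) → (B → A) → Reflects A b → Reflects B b
reflects-map f g (ofʸ a)  = ofʸ (f a)
reflects-map f g (ofⁿ ¬a) = ofⁿ (¬a ∘ g)

module _ (v : Vec Bool N) {i j : Fin N} where

  cmp-max : vlookup (applyGate v (cmp i j)) j ≡ vlookup v i ∨ vlookup v j
  cmp-max = lookup∘update j (v [ i ]≔ _) _

  cmp-min : i ≢ j → vlookup (applyGate v (cmp i j)) i ≡ vlookup v i ∧ vlookup v j
  cmp-min i≢j = trans (lookup∘update′ i≢j (v [ i ]≔ _) _) (lookup∘update i v _)

  cmp-other : ∀ {l} → l ≢ i → l ≢ j → vlookup (applyGate v (cmp i j)) l ≡ vlookup v l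
  cmp-other l≢i l≢j = trans (lookup∘update′ l≢j (v [ i ]≔ _) _) (lookup∘update′ l≢i v _)

-- Both outputs go to the same wire, the second write wins, and it stores p ∨ p = p. This makes the
-- gate a padding gate.
cmp-self : ∀ (v : Vec Bool N) i l → vlookup (applyGate v (cmp i i)) l ≡ vlookup v l
cmp-self v i l with l ≟F i
... | yes refl = trans (cmp-max v) (∨-idem _)
... | no l≢i   = cmp-other v l≢i l≢i

-- `D` is a footprint: nothing outside it changes, and what happens inside depends on nothing
-- outside. Lists with disjoint footprints may be run one after the other as if they ran in
-- parallel.
record Acts (gs : List (Gate N)) (D : Fin N → Set) : Set where
  field
    untouched : ∀ v l → ¬ D l → vlookup (runCircuit gs v) l ≡ vlookup v l
    local     : ∀ v v' → (∀ l → D l → vlookup v l ≡ vlookup v' l) →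
                ∀ l → D l → vlookup (runCircuit gs v) l ≡ vlookup (runCircuit gs v') l
open Acts

run-++ : ∀ (gs hs : List (Gate N)) v → runCircuit (gs ++ hs) v ≡ runCircuit hs (runCircuit gs v)
run-++ gs hs v = foldl-++ applyGate v gs hs

parallel-untouched : {gss : Fin m → List (Gate N)} {D : Fin m → Fin N → Set} →
                     (∀ a → Acts (gss a) (D a)) → ∀ v l → (∀ a → ¬ D a l) →
                     vlookup (runCircuit (concat (tabulate gss)) v) l ≡ vlookup v l
parallel-untouched {m = zero} acts v l ¬d = refl
parallel-untouched {m = suc m} {gss = gss} acts v l ¬d =
  trans (cong (λ u → vlookup u l) (run-++ (gss zero) _ v))
    (trans (parallel-untouched (acts ∘ suc) _ l (¬d ∘ suc)) (untouched (acts zero) v l (¬d zero)))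

-- The lists before `a` leave the footprint of `a` alone, so `local` gives the result of running
-- `gss a` on the original vector; the later lists do not touch `l`.
parallel-at : {gss : Fin m → List (Gate N)} {D : Fin m → Fin N → Set}
              (acts : ∀ a → Acts (gss a) (D a)) (disjoint : ∀ {a b l} → D a l → D b l → a ≡ b) →
              ∀ v {l} a → D a l →
              vlookup (runCircuit (concat (tabulate gss)) v) l ≡ vlookup (runCircuit (gss a) v) l
parallel-at {gss = gss} acts disjoint v {l} zero d =
  trans (cong (λ u → vlookup u l) (run-++ (gss zero) _ v))
    (parallel-untouched (acts ∘ suc) _ l λ a d' → 0≢1+n (disjoint d d'))
parallel-at {gss = gss} {D} acts disjoint v {l} (suc a) d =
  trans (cong (λ u → vlookup u l) (run-++ (gss zero) _ v))
    (trans (parallel-at (acts ∘ suc) (λ d d' → sucF-injective (disjoint d d')) _ a d)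
      (local (acts (suc a)) _ v (λ l' d' → untouched (acts zero) v l' λ d₀ → 0≢1+n (disjoint d₀ d')) l d))

parallel : {gss : Fin m → List (Gate N)} {D : Fin m → Fin N → Set} →
           (∀ a → Acts (gss a) (D a)) → (∀ {a b l} → D a l → D b l → a ≡ b) →
           Acts (concat (tabulate gss)) (λ l → ∃ λ a → D a l)
untouched (parallel acts disjoint) v l ¬d = parallel-untouched acts v l (λ a d → ¬d (a , d))
local (parallel acts disjoint) v v' same l (a , d) =
  trans (parallel-at acts disjoint v a d)
    (trans (local (acts a) v v' (λ l' d' → same l' (a , d')) l d)
      (sym (parallel-at acts disjoint v' a d)))

cmp-acts : (i j : Fin N) → Acts (cmp i j ∷ []) (λ l → l ≡ i ⊎ l ≡ j)
untouched (cmp-acts i j) v l ¬d = cmp-other v (¬d ∘ inj₁) (¬d ∘ inj₂)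
local (cmp-acts i j) v v' same l d with l ≟F j
... | yes refl = trans (cmp-max v) (trans (cong₂ _∨_ (same i (inj₁ refl)) (same j (inj₂ refl))) (sym (cmp-max v')))
... | no l≢j with d
...   | inj₂ l≡j  = ⊥-elim (l≢j l≡j)
...   | inj₁ refl = trans (cmp-min v l≢j)
                      (trans (cong₂ _∧_ (same i (inj₁ refl)) (same j (inj₂ refl))) (sym (cmp-min v' l≢j)))

-- A comparator in both cases, so that the condition influences nothing but the second wire field of
-- the encoded gate.
cmpIf : Bool → Fin N → Fin N → Gate N
cmpIf c i j = cmp i (if c then j else i)

ngtIf : Bool → Fin N → Gate N
ngtIf c i = if c then ngt i else cmp i i

-- The footprint is empty when `C` fails. This matters because many padding gates name the same
-- wires; only the active ones have disjoint footprints.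
cmpIf-acts : ∀ {C : Set} (c : Dec C) (i j : Fin N) → Acts (cmpIf (does c) i j ∷ []) (λ l → C × (l ≡ i ⊎ l ≡ j))
cmpIf-acts (yes c) i j = record
  { untouched = λ v l ¬d → untouched (cmp-acts i j) v l (λ d → ¬d (c , d))
  ; local     = λ { v v' same l (_ , d) → local (cmp-acts i j) v v' (λ l' d' → same l' (c , d')) l d } }
cmpIf-acts (no ¬c) i j = record
  { untouched = λ v l _ → cmp-self v i l
  ; local     = λ { _ _ _ _ (c , _) → ⊥-elim (¬c c) } }

ngtIf-acts : ∀ {C : Set} (c : Dec C) (i : Fin N) → Acts (ngtIf (does c) i ∷ []) (λ l → C × l ≡ i)
ngtIf-acts (yes c) i = record
  { untouched = λ v l ¬d → lookup∘update′ (λ e → ¬d (c , e)) v _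
  ; local     = λ { v v' same l (_ , refl) → trans (lookup∘update i v _)
                      (trans (cong not (same i (c , refl))) (sym (lookup∘update i v' _))) } }
ngtIf-acts (no ¬c) i = record
  { untouched = λ v l _ → cmp-self v i l
  ; local     = λ { _ _ _ _ (c , _) → ⊥-elim (¬c c) } }

cmpIf-max : ∀ {C : Set} (c : Dec C) {i j : Fin N} v → C →
            vlookup (applyGate v (cmpIf (does c) i j)) j ≡ vlookup v i ∨ vlookup v j
cmpIf-max (yes _) v _ = cmp-max v
cmpIf-max (no ¬c) v c = ⊥-elim (¬c c)

ngtIf-flips : ∀ {C : Set} (c : Dec C) {i : Fin N} v → C →
              vlookup (applyGate v (ngtIf (does c) i)) i ≡ not (vlookup v i)
ngtIf-flips (yes _) {i} v _ = lookup∘update i v _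
ngtIf-flips (no ¬c) v c = ⊥-elim (¬c c)

run-induction : ∀ {K} (layer : Fin K → List (Gate N)) (Inv : Fin (suc K) → Vec Bool N → Set) →
                (∀ k v → Inv (inject₁ k) v → Inv (suc k) (runCircuit (layer k) v)) →
                ∀ v → Inv zero v → Inv (fromℕ K) (runCircuit (concat (tabulate layer)) v)
run-induction {K = zero}  layer Inv step v inv = inv
run-induction {K = suc K} layer Inv step v inv =
  subst (Inv (suc (fromℕ K))) (sym (run-++ (layer zero) _ v))
    (run-induction (layer ∘ suc) (Inv ∘ suc) (λ k → step (suc k)) _ (step zero v inv))

-- The network and its invariant

module Network {n} (mp wp : Pref n) where
  open DeferredAcceptance mp wp

  wires : ℕ
  wires = suc rounds * (2 * (n * n))

  -- Opaque, so that unification recovers the coordinates of a wire.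
  opaque
    wire : Fin (suc rounds) → Fin 2 → Fin n → Fin n → Fin wires
    wire k s x y = combine k (combine s (combine x y))

    wire-injective : ∀ {k k' s s' x x' y y'} → wire k s x y ≡ wire k' s' x' y' →
                     k ≡ k' × s ≡ s' × x ≡ x' × y ≡ y'
    wire-injective {k} {k'} {s} {s'} {x} {x'} {y} {y'} e
      with refl , e₁ ← combine-injective k _ k' _ e
      with refl , e₂ ← combine-injective s _ s' _ e₁
      with refl , refl ← combine-injective x y x' y' e₂
      = refl , refl , refl , refl

    toℕ-wire : ∀ k s x y → toℕ (wire k s x y) ≡
               2 * (n * n) * toℕ k + (n * n * toℕ s + (n * toℕ x + toℕ y))
    toℕ-wire k s x y = trans (toℕ-combine k _) (cong (2 * (n * n) * toℕ k +_)
      (trans (toℕ-combine s _) (cong (n * n * toℕ s +_) (toℕ-combine x y))))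

  comparisons : Fin rounds → List (Gate wires)
  comparisons k = concat (tabulate λ x → concat (tabulate λ y →
    cmp (wire (inject₁ k) zero x y) (wire (inject₁ k) (suc zero) y x) ∷ []))

  -- On a target wire that carries 0, a comparator is a move: the source becomes v ∧ 0 = 0 and the
  -- target v ∨ 0 = v.
  moves : Fin 2 → Pref n → Fin rounds → List (Gate wires)
  moves s p k = concat (tabulate λ x → concat (tabulate λ y → concat (tabulate λ z →
    cmpIf (does (next? p x y z)) (wire (inject₁ k) s x y) (wire (suc k) s x z) ∷ [])))

  -- A first choice has no predecessor, so no move reaches its wire in the new round; the wire still
  -- carries 0 and a negation sets it to the value 1 that `P` has there.
  sources : Fin rounds → List (Gate wires)
  sources k = concat (tabulate λ x → concat (tabulate λ y →
    ngtIf (does (first? mp x y)) (wire (suc k) zero x y) ∷ []))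

  layer : Fin rounds → List (Gate wires)
  layer k = comparisons k ++ moves zero mp k ++ moves (suc zero) wp k ++ sources k

  -- After the negation, the minimum on the first wire is "proposed and not turned down", which is
  -- `Matched`; that wire is the designated output.
  readout : Fin n → Fin n → List (Gate wires)
  readout a b = ngt (wire (fromℕ rounds) (suc zero) b a) ∷
                cmp (wire (fromℕ rounds) zero a b) (wire (fromℕ rounds) (suc zero) b a) ∷ []

  network : Fin n → Fin n → List (Gate wires)
  network a b = concat (tabulate layer) ++ readout a b

  inject₁≢suc : ∀ {K} (k : Fin K) → inject₁ k ≢ suc k
  inject₁≢suc (suc k) e = inject₁≢suc k (sucF-injective e)

  module _ (k : Fin rounds) where

    private
      CD : Fin n → Fin n → Fin wires → Set
      CD x y l = l ≡ wire (inject₁ k) zero x y ⊎ l ≡ wire (inject₁ k) (suc zero) y x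

      -- This is the absence of fan-out: a wire of round `k` determines the only pair whose
      -- comparator reads it.
      CD-cell : ∀ {x y x' y' l} → CD x y l → CD x' y' l → x ≡ x' × y ≡ y'
      CD-cell (inj₁ refl) (inj₁ e) with refl , refl , refl , refl ← wire-injective e = refl , refl
      CD-cell (inj₁ refl) (inj₂ e) with _ , () , _ ← wire-injective e
      CD-cell (inj₂ refl) (inj₁ e) with _ , () , _ ← wire-injective e
      CD-cell (inj₂ refl) (inj₂ e) with refl , refl , refl , refl ← wire-injective e = refl , refl

      row-acts : ∀ x → Acts _ (λ l → ∃ λ y → CD x y l)
      row-acts x = parallel (λ y → cmp-acts _ _) (λ d d' → proj₂ (CD-cell d d'))

      cell : ∀ v x y {l} → CD x y l → vlookup (runCircuit (comparisons k) v) l ≡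
             vlookup (applyGate v (cmp (wire (inject₁ k) zero x y) (wire (inject₁ k) (suc zero) y x))) l
      cell v x y d =
        trans (parallel-at row-acts (λ { (_ , d) (_ , d') → proj₁ (CD-cell d d') }) v x (y , d))
              (parallel-at (λ y → cmp-acts _ _) (λ d d' → proj₂ (CD-cell {x} {_} {x} d d')) v y d)

    comparisons-min : ∀ v x y → vlookup (runCircuit (comparisons k) v) (wire (inject₁ k) zero x y) ≡
      vlookup v (wire (inject₁ k) zero x y) ∧ vlookup v (wire (inject₁ k) (suc zero) y x)
    comparisons-min v x y = trans (cell v x y (inj₁ refl)) (cmp-min v sides-differ)
      where
      sides-differ : wire (inject₁ k) zero x y ≢ wire (inject₁ k) (suc zero) y x
      sides-differ e with _ , () , _ ← wire-injective e

    comparisons-max : ∀ v x y → vlookup (runCircuit (comparisons k) v) (wire (inject₁ k) (suc zero) y x) ≡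
      vlookup v (wire (inject₁ k) zero x y) ∨ vlookup v (wire (inject₁ k) (suc zero) y x)
    comparisons-max v x y = trans (cell v x y (inj₂ refl)) (cmp-max v)

    comparisons-other : ∀ v {j s x y} → j ≢ inject₁ k →
      vlookup (runCircuit (comparisons k) v) (wire j s x y) ≡ vlookup v (wire j s x y)
    comparisons-other v j≢k = parallel-untouched row-acts v _ λ
      { _ (_ , inj₁ e) → j≢k (proj₁ (wire-injective e))
      ; _ (_ , inj₂ e) → j≢k (proj₁ (wire-injective e)) }

    module _ (s : Fin 2) {p : Pref n} (strict : StrictTotalRows p) where
      private
        open Rows strict

        MD : Fin n → Fin n → Fin n → Fin wires → Set
        MD x y z l = Next p x y z × (l ≡ wire (inject₁ k) s x y ⊎ l ≡ wire (suc k) s x z)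

        -- A source wire determines its target because successors are unique, and a target its
        -- source because predecessors are; sources and targets lie in different rounds.
        MD-cell : ∀ {x y z x' y' z' l} → MD x y z l → MD x' y' z' l → x ≡ x' × y ≡ y' × z ≡ z'
        MD-cell (nx , inj₁ refl) (nx' , inj₁ e) with refl , refl , refl , refl ← wire-injective e =
          refl , refl , next-uniqueʳ nx nx'
        MD-cell (nx , inj₁ refl) (nx' , inj₂ e) = ⊥-elim (inject₁≢suc k (proj₁ (wire-injective e)))
        MD-cell (nx , inj₂ refl) (nx' , inj₁ e) = ⊥-elim (inject₁≢suc k (sym (proj₁ (wire-injective e))))
        MD-cell (nx , inj₂ refl) (nx' , inj₂ e) with refl , refl , refl , refl ← wire-injective e =
          refl , next-uniqueˡ nx nx' , refl

        gate-acts : ∀ x y z → Acts _ (MD x y z)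
        gate-acts x y z = cmpIf-acts (next? p x y z) _ _

        z-disjoint : ∀ {x y a b l} → MD x y a l → MD x y b l → a ≡ b
        z-disjoint d d' = proj₂ (proj₂ (MD-cell d d'))

        cell-acts : ∀ x y → Acts _ (λ l → ∃ λ z → MD x y z l)
        cell-acts x y = parallel (gate-acts x y) z-disjoint

        y-disjoint : ∀ {x a b l} → ∃ (λ z → MD x a z l) → ∃ (λ z → MD x b z l) → a ≡ b
        y-disjoint (_ , d) (_ , d') = proj₁ (proj₂ (MD-cell d d'))

        move-row-acts : ∀ x → Acts _ (λ l → ∃ λ y → ∃ λ z → MD x y z l)
        move-row-acts x = parallel (cell-acts x) y-disjoint

      moves-target : ∀ v {x y z} → Next p x y z →
        vlookup (runCircuit (moves s p k) v) (wire (suc k) s x z) ≡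
        vlookup v (wire (inject₁ k) s x y) ∨ vlookup v (wire (suc k) s x z)
      moves-target v {x} {y} {z} nx =
        trans (parallel-at move-row-acts (λ { (_ , _ , d) (_ , _ , d') → proj₁ (MD-cell d d') }) v x (y , z , d))
        (trans (parallel-at (cell-acts x) y-disjoint v y (z , d))
        (trans (parallel-at (gate-acts x y) z-disjoint v z d) (cmpIf-max (next? p x y z) v nx)))
        where
        d : MD x y z (wire (suc k) s x z)
        d = nx , inj₂ refl

      moves-untouched : ∀ v l → (∀ x y z → Next p x y z → l ≢ wire (inject₁ k) s x y × l ≢ wire (suc k) s x z) →
        vlookup (runCircuit (moves s p k) v) l ≡ vlookup v l
      moves-untouched v l away = parallel-untouched move-row-acts v l λ
        { x (y , z , nx , inj₁ e) → proj₁ (away x y z nx) e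
        ; x (y , z , nx , inj₂ e) → proj₂ (away x y z nx) e }

      moves-side : ∀ v {j s' x y} → s' ≢ s →
        vlookup (runCircuit (moves s p k) v) (wire j s' x y) ≡ vlookup v (wire j s' x y)
      moves-side v s'≢s = moves-untouched v _ λ _ _ _ _ →
        (λ e → s'≢s (proj₁ (proj₂ (wire-injective e)))) , (λ e → s'≢s (proj₁ (proj₂ (wire-injective e))))

      moves-layer : ∀ v {j s' x y} → j ≢ inject₁ k → j ≢ suc k →
        vlookup (runCircuit (moves s p k) v) (wire j s' x y) ≡ vlookup v (wire j s' x y)
      moves-layer v j≢k j≢k+1 = moves-untouched v _ λ _ _ _ _ →
        (λ e → j≢k (proj₁ (wire-injective e))) , (λ e → j≢k+1 (proj₁ (wire-injective e)))

      -- Either `z` has no predecessor and its wire stays blank, or it has exactly one and receives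
      -- that value. Both cases agree with the existential over predecessors.
      moves-reflects : ∀ v {A : Fin n → Fin n → Set} →
        (∀ x y → Reflects (A x y) (vlookup v (wire (inject₁ k) s x y))) →
        (∀ x z → vlookup v (wire (suc k) s x z) ≡ false) →
        ∀ x z → Reflects (∃ λ y → Next p x y z × A x y) (vlookup (runCircuit (moves s p k) v) (wire (suc k) s x z))
      moves-reflects v {A} here blank x z with any? (λ y → next? p x y z)
      ... | no none = subst (Reflects _)
              (sym (trans (moves-untouched v _ (λ x' y' z' nx →
                 (λ e → inject₁≢suc k (sym (proj₁ (wire-injective e)))) ,
                 (λ e → none (y' , subst₂ (λ u t → Next p u y' t)
                    (sym (proj₁ (proj₂ (proj₂ (wire-injective e))))) (sym (proj₂ (proj₂ (proj₂ (wire-injective e))))) nx))))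
                 (blank x z)))
              (ofⁿ λ { (y , nx , _) → none (y , nx) })
      ... | yes (y , nx) = subst (Reflects _)
              (sym (trans (moves-target v nx) (trans (cong (vlookup v (wire (inject₁ k) s x y) ∨_) (blank x z)) (∨-identityʳ _))))
              (reflects-map (λ a → y , nx , a) (λ { (y' , nx' , a) → subst (A x) (next-uniqueˡ nx' nx) a }) (here x y))

    private
      SD : Fin n → Fin n → Fin wires → Set
      SD x y l = First mp x y × l ≡ wire (suc k) zero x y

      SD-cell : ∀ {x y x' y' l} → SD x y l → SD x' y' l → x ≡ x' × y ≡ y'
      SD-cell (_ , refl) (_ , e) = proj₂ (proj₂ (wire-injective e))

      source-acts : ∀ x y → Acts _ (SD x y)
      source-acts x y = ngtIf-acts (first? mp x y) _

      source-row-acts : ∀ x → Acts _ (λ l → ∃ λ y → SD x y l)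
      source-row-acts x = parallel (source-acts x) (λ d d' → proj₂ (SD-cell d d'))

    sources-other : ∀ v l → (∀ x y → First mp x y → l ≢ wire (suc k) zero x y) →
      vlookup (runCircuit (sources k) v) l ≡ vlookup v l
    sources-other v l away = parallel-untouched source-row-acts v l λ { x (y , f , e) → away x y f e }

    sources-first : ∀ v {x y} → First mp x y →
      vlookup (runCircuit (sources k) v) (wire (suc k) zero x y) ≡ not (vlookup v (wire (suc k) zero x y))
    sources-first v {x} {y} f =
      trans (parallel-at source-row-acts (λ { (_ , d) (_ , d') → proj₁ (SD-cell d d') }) v x (y , f , refl))
      (trans (parallel-at (source-acts x) (λ d d' → proj₂ (SD-cell d d')) v y (f , refl)) (ngtIf-flips (first? mp x y) v f))

  module _ (mp-strict : StrictTotalRows mp) (wp-strict : StrictTotalRows wp) where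

    -- Nothing is said about wires of earlier rounds, which keep leftovers of the comparisons and
    -- moves. Wires of later rounds have to be 0, as a move works only into a blank wire.
    record Holds (k : Fin (suc rounds)) (v : Vec Bool wires) : Set where
      field
        proposals  : ∀ m w → Reflects (P (toℕ k) m w) (vlookup v (wire k zero m w))
        rejections : ∀ w m → Reflects (T (toℕ k) w m) (vlookup v (wire k (suc zero) w m))
        blank      : ∀ j s x y → toℕ k < toℕ j → vlookup v (wire j s x y) ≡ false
    open Holds

    layer-holds : ∀ k v → Holds (inject₁ k) v → Holds (suc k) (runCircuit (layer k) v)
    layer-holds k v h = subst (Holds (suc k)) (sym run-layer) record
      { proposals  = proposals₄
      ; rejections = λ w m → subst (Reflects _) (sym (sources-other k v₃ _ (λ x y _ → sides-differ))) (rejections₃ w m)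
      ; blank      = blank₄ }
      where
      v₁ = runCircuit (comparisons k) v
      v₂ = runCircuit (moves zero mp k) v₁
      v₃ = runCircuit (moves (suc zero) wp k) v₂
      v₄ = runCircuit (sources k) v₃

      run-layer : runCircuit (layer k) v ≡ v₄
      run-layer = trans (run-++ (comparisons k) _ v)
                 (trans (run-++ (moves zero mp k) _ v₁) (run-++ (moves (suc zero) wp k) _ v₂))

      sides-differ : ∀ {j j' x y x' y'} → wire j (suc zero) x y ≢ wire j' zero x' y'
      sides-differ e with _ , () , _ ← wire-injective e

      before : ∀ {j} → toℕ k < toℕ j → j ≢ inject₁ k
      before lt refl = <-irrefl (sym (toℕ-inject₁ k)) lt

      blank₁ : ∀ j s x y → toℕ k < toℕ j → vlookup v₁ (wire j s x y) ≡ false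
      blank₁ j s x y lt = trans (comparisons-other k v (before lt))
        (blank h j s x y (subst (_< toℕ j) (sym (toℕ-inject₁ k)) lt))

      k<k+1 : toℕ k < toℕ (Fin.suc k)
      k<k+1 = n<1+n (toℕ k)

      p₀ : ∀ m w → Reflects (P (toℕ k) m w) (vlookup v (wire (inject₁ k) zero m w))
      p₀ m w = subst (λ i → Reflects (P i m w) (vlookup v (wire (inject₁ k) zero m w))) (toℕ-inject₁ k) (proposals h m w)

      t₀ : ∀ w m → Reflects (T (toℕ k) w m) (vlookup v (wire (inject₁ k) (suc zero) w m))
      t₀ w m = subst (λ i → Reflects (T i w m) (vlookup v (wire (inject₁ k) (suc zero) w m))) (toℕ-inject₁ k) (rejections h w m)

      p₁ : ∀ m w → Reflects (P (toℕ k) m w × T (toℕ k) w m) (vlookup v₁ (wire (inject₁ k) zero m w))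
      p₁ m w = subst (Reflects _) (sym (comparisons-min k v m w)) (p₀ m w ×-reflects t₀ w m)

      t₁ : ∀ w m → Reflects (P (toℕ k) m w ⊎ T (toℕ k) w m) (vlookup v₁ (wire (inject₁ k) (suc zero) w m))
      t₁ w m = subst (Reflects _) (sym (comparisons-max k v m w)) (p₀ m w ⊎-reflects t₀ w m)

      p₂ : ∀ m w → Reflects (∃ λ u → Next mp m u w × P (toℕ k) m u × T (toℕ k) u m)
                            (vlookup v₂ (wire (suc k) zero m w))
      p₂ = moves-reflects k zero mp-strict v₁ p₁ (λ x z → blank₁ _ _ x z k<k+1)

      p₃ : ∀ m w → Reflects (∃ λ u → Next mp m u w × P (toℕ k) m u × T (toℕ k) u m)
                            (vlookup v₃ (wire (suc k) zero m w))
      p₃ m w = subst (Reflects _) (sym (moves-side k (suc zero) wp-strict v₂ (λ ()))) (p₂ m w)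

      rejections₃ : ∀ w m → Reflects (T (suc (toℕ k)) w m) (vlookup v₃ (wire (suc k) (suc zero) w m))
      rejections₃ = moves-reflects k (suc zero) wp-strict v₂
        (λ w m → subst (Reflects _) (sym (moves-side k zero mp-strict v₁ (λ ()))) (t₁ w m))
        (λ x z → trans (moves-side k zero mp-strict v₁ (λ ())) (blank₁ _ _ x z k<k+1))

      proposals₄ : ∀ m w → Reflects (P (suc (toℕ k)) m w) (vlookup v₄ (wire (suc k) zero m w))
      proposals₄ m w with first? mp m w
      -- Nobody precedes a first choice, so the existential established by the moves is false, and
      -- its negation is the value of `P` in the next round.
      ... | yes f = subst (Reflects _) (sym (sources-first k v₃ f))
              (reflects-map (λ _ → inj₁ f) (λ _ → λ { (u , (uw , _) , _) → f u uw }) (¬-reflects (p₃ m w)))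
      ... | no ¬f = subst (Reflects _) (sym (sources-other k v₃ _ (λ x y f e → ¬f
              (subst₂ (First mp) (sym (proj₁ (proj₂ (proj₂ (wire-injective e))))) (sym (proj₂ (proj₂ (proj₂ (wire-injective e))))) f))))
              (reflects-map inj₂ (λ { (inj₁ f) → ⊥-elim (¬f f) ; (inj₂ r) → r }) (p₃ m w))

      blank₄ : ∀ j s x y → suc (toℕ k) < toℕ j → vlookup v₄ (wire j s x y) ≡ false
      blank₄ j s x y lt =
        trans (sources-other k v₃ _ (λ _ _ _ e → after (proj₁ (wire-injective e))))
        (trans (moves-layer k (suc zero) wp-strict v₂ (before (<⇒≤ lt)) after)
        (trans (moves-layer k zero mp-strict v₁ (before (<⇒≤ lt)) after) (blank₁ j s x y (<⇒≤ lt))))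
        where
        after : j ≢ suc k
        after refl = <-irrefl refl lt

    network-correct : ∀ a b → Reflects (Matched a b)
      (vlookup (runCircuit (network a b) (V.replicate wires false)) (wire (fromℕ rounds) zero a b))
    network-correct a b = subst (Reflects _) (sym value) (p ×-reflects ¬-reflects t)
      where
      v₀ = V.replicate wires false
      v = runCircuit (concat (tabulate layer)) v₀
      i = wire (fromℕ rounds) zero a b
      j = wire (fromℕ rounds) (suc zero) b a

      i≢j : i ≢ j
      i≢j e with _ , () , _ ← wire-injective e

      start : Holds zero v₀
      start = record
        { proposals  = λ m w → subst (Reflects ⊥) (sym (lookup-replicate (wire zero zero m w) false)) (ofⁿ λ ())
        ; rejections = λ w m → subst (Reflects ⊥) (sym (lookup-replicate (wire zero (suc zero) w m) false)) (ofⁿ λ ())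
        ; blank      = λ j s x y _ → lookup-replicate (wire j s x y) false }

      h : Holds (fromℕ rounds) v
      h = run-induction layer Holds layer-holds v₀ start

      p : Reflects (P rounds a b) (vlookup v i)
      p = subst (λ k → Reflects (P k a b) (vlookup v i)) (toℕ-fromℕ rounds) (proposals h a b)

      t : Reflects (T rounds b a) (vlookup v j)
      t = subst (λ k → Reflects (T k b a) (vlookup v j)) (toℕ-fromℕ rounds) (rejections h b a)

      value : vlookup (runCircuit (network a b) v₀) i ≡ vlookup v i ∧ not (vlookup v j)
      value = trans (cong (λ u → vlookup u i) (run-++ (concat (tabulate layer)) (readout a b) v₀))
        (trans (cmp-min (applyGate v (ngt j)) i≢j)
          (cong₂ _∧_ (lookup∘update′ i≢j v _) (lookup∘update j v _)))

-- Σ^B_0 descriptions of strings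

bit-++ˡ : ∀ (S : Str) {S'} {i} → i < length S → bit (S ++ S') i ≡ bit S i
bit-++ˡ (_ ∷ S) {i = zero}  _        = refl
bit-++ˡ (_ ∷ S) {i = suc i} (s≤s lt) = bit-++ˡ S lt

bit-++ʳ : ∀ (S : Str) {S'} j → bit (S ++ S') (length S + j) ≡ bit S' j
bit-++ʳ []      j = refl
bit-++ʳ (_ ∷ S) j = bit-++ʳ S j

bit-tabulate : ∀ (f : Fin n → Bool) a → bit (tabulate f) (toℕ a) ≡ f a
bit-tabulate f zero    = refl
bit-tabulate f (suc a) = bit-tabulate (f ∘ suc) a

str-ext : ∀ {S S'} → length S ≡ length S' → (∀ i → i < length S → bit S i ≡ bit S' i) → S ≡ S'
str-ext {[]}    {[]}     _  _    = refl
str-ext {b ∷ S} {c ∷ S'} le same =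
  cong₂ _∷_ (same 0 (s≤s z≤n)) (str-ext (suc-injective le) (λ i lt → same (suc i) (s≤s lt)))

module _ {u : ℕ} where

  length-blocks : ∀ (f : Fin n → Str) → (∀ a → length (f a) ≡ u) → length (concat (tabulate f)) ≡ n * u
  length-blocks {zero}  f w = refl
  length-blocks {suc n} f w =
    trans (length-++ (f zero)) (cong₂ _+_ (w zero) (length-blocks (f ∘ suc) (w ∘ suc)))

  bit-blocks : ∀ (f : Fin n → Str) → (∀ a → length (f a) ≡ u) → ∀ a {r} → r < u →
               bit (concat (tabulate f)) (toℕ a * u + r) ≡ bit (f a) r
  bit-blocks f w zero    {r} lt = bit-++ˡ (f zero) (subst (r <_) (sym (w zero)) lt)
  bit-blocks f w (suc a) {r} lt =
    trans (cong (bit (concat (tabulate f))) (trans (+-assoc u (toℕ a * u) r) (cong (_+ (toℕ a * u + r)) (sym (w zero)))))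
      (trans (bit-++ʳ (f zero) (toℕ a * u + r)) (bit-blocks (f ∘ suc) (w ∘ suc) a lt))

reflects-true : ∀ b → Reflects (b ≡ true) b
reflects-true true  = ofʸ refl
reflects-true false = ofⁿ λ ()

reflects-yes : ∀ {A : Set} {b} → Reflects A b → A → b ≡ true
reflects-yes (ofʸ _)  a = refl
reflects-yes (ofⁿ ¬a) a = ⊥-elim (¬a a)

reflects-elim : ∀ {A : Set} {b} → Reflects A b → b ≡ true → A
reflects-elim (ofʸ a) _ = a

-- Stated for every generator `g`, because the tail of `applyUpTo g` is generated by `g ∘ suc`.
any-applyUpTo : ∀ {f : ℕ → Bool} {A : ℕ → Set} → (∀ x → Reflects (A x) (f x)) → ∀ (g : ℕ → ℕ) m →
                Reflects (∃ λ x → x < m × A (g x)) (any f (applyUpTo g m))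
any-applyUpTo r g zero    = ofⁿ λ ()
any-applyUpTo {f} {A} r g (suc m) =
  reflects-map to from (r (g 0) ⊎-reflects any-applyUpTo r (g ∘ suc) m)
  where
  to : A (g 0) ⊎ (∃ λ x → x < m × A (g (suc x))) → ∃ λ x → x < suc m × A (g x)
  to (inj₁ a)            = 0 , s≤s z≤n , a
  to (inj₂ (x , lt , a)) = suc x , s≤s lt , a
  from : (∃ λ x → x < suc m × A (g x)) → A (g 0) ⊎ (∃ λ x → x < m × A (g (suc x)))
  from (zero  , _      , a) = inj₁ a
  from (suc x , s≤s lt , a) = inj₂ (x , lt , a)

-- Renaming of variables, and codes of strings

renT : (Fin k → Fin l) → Term k → Term l
renT r (var i) = var (r i)
renT r `0      = `0
renT r `1      = `1
renT r (t ⊕ u) = renT r t ⊕ renT r u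
renT r (t ⊗ u) = renT r t ⊗ renT r u
renT r ∣X∣     = ∣X∣

renF : (Fin k → Fin l) → Form k → Form l
renF r (mem t)    = mem (renT r t)
renF r (eq t u)   = eq (renT r t) (renT r u)
renF r (leq t u)  = leq (renT r t) (renT r u)
renF r (neg φ)    = neg (renF r φ)
renF r (conj φ ψ) = conj (renF r φ) (renF r ψ)
renF r (disj φ ψ) = disj (renF r φ) (renF r ψ)
renF r (exB t φ)  = exB (renT r t) (renF (lift 1 r) φ)
renF r (allB t φ) = allB (renT r t) (renF (lift 1 r) φ)

wk : Term k → Term (suc k)
wk = renT suc

wkF : Form k → Form (suc k)
wkF = renF suc

wks : ∀ j → Term k → Term (j + k)
wks zero    t = t
wks (suc j) t = wk (wks j t)

v0 : Term (1 + k)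
v0 = var zero

v1 : Term (2 + k)
v1 = var (suc zero)

v2 : Term (3 + k)
v2 = var (suc (suc zero))

v3 : Term (4 + k)
v3 = var (suc (suc (suc zero)))

`2 : Term k
`2 = `1 ⊕ `1

-- Bounded quantifiers of Form include the bound itself; these exclude it.
∃< : Term k → Form (suc k) → Form k
∃< t φ = exB t (conj (leq (`1 ⊕ v0) (wk t)) φ)

∀< : Term k → Form (suc k) → Form k
∀< t φ = neg (∃< t (neg φ))

falseF trueF : Form k
falseF = eq `0 `1
trueF  = eq `0 `0

-- A term for the length of a string and a formula for its bits (variable 0 is the position).
record Code (k : ℕ) : Set where
  no-eta-equality
  constructor ⟨_,_⟩
  field
    len  : Term k
    bits : Form (suc k)
open Code

infixr 5 _⧺_
-- There is no subtraction among the terms, so the offset into the second string is quantified,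
-- bounded by the position. The renaming `lift 1 suc` keeps this offset as the position for `d` and
-- skips the absolute one.
_⧺_ : Code k → Code k → Code k
len  (c ⧺ d) = len c ⊕ len d
bits (c ⧺ d) = disj (conj (leq (`1 ⊕ v0) (wk (len c))) (bits c))
                    (exB v0 (conj (eq v1 (wk (wk (len c)) ⊕ v0)) (renF (lift 1 suc) (bits d))))

-- The concatenation of t blocks of width u, the bits of block q being given by c with variable 0 set to q.
blocks : Term k → Term k → Code (suc k) → Code k
len  (blocks t u c) = t ⊗ u
bits (blocks t u c) =
  exB v0 (exB v1 (conj (eq v2 ((v1 ⊗ wk (wk (wk u))) ⊕ v0))
                 (conj (leq (`1 ⊕ v0) (wk (wk (wk u)))) (renF (lift 2 suc) (bits c)))))

single : Form k → Code k
single φ = ⟨ `1 , wkF φ ⟩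

unaryC : Term k → Code k
unaryC t = ⟨ t , trueF ⟩ ⧺ single falseF

-- Correctness of codes

module Semantics (X : Str) where

  evalT-ren : ∀ (r : Fin k → Fin l) {ρ ρ'} → (∀ i → vlookup ρ' (r i) ≡ vlookup ρ i) →
              ∀ t → evalT (renT r t) ρ' X ≡ evalT t ρ X
  evalT-ren r e (var i) = e i
  evalT-ren r e `0      = refl
  evalT-ren r e `1      = refl
  evalT-ren r e (t ⊕ u) = cong₂ _+_ (evalT-ren r e t) (evalT-ren r e u)
  evalT-ren r e (t ⊗ u) = cong₂ _*_ (evalT-ren r e t) (evalT-ren r e u)
  evalT-ren r e ∣X∣     = refl

  lift-env : ∀ (r : Fin k → Fin l) {ρ : Vec ℕ k} {ρ' : Vec ℕ l} x → (∀ i → vlookup ρ' (r i) ≡ vlookup ρ i) →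
             ∀ i → vlookup (x ∷ ρ') (lift 1 r i) ≡ vlookup (x ∷ ρ) i
  lift-env r x e zero    = refl
  lift-env r x e (suc i) = e i

  evalF-ren : ∀ (r : Fin k → Fin l) {ρ ρ'} → (∀ i → vlookup ρ' (r i) ≡ vlookup ρ i) →
              ∀ φ → evalF (renF r φ) ρ' X ≡ evalF φ ρ X
  evalF-ren r e (mem t)    = cong (bit X) (evalT-ren r e t)
  evalF-ren r e (eq t u)   = cong₂ _≡ᵇ_ (evalT-ren r e t) (evalT-ren r e u)
  evalF-ren r e (leq t u)  = cong₂ _≤ᵇ_ (evalT-ren r e t) (evalT-ren r e u)
  evalF-ren r e (neg φ)    = cong not (evalF-ren r e φ)
  evalF-ren r e (conj φ ψ) = cong₂ _∧_ (evalF-ren r e φ) (evalF-ren r e ψ)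
  evalF-ren r e (disj φ ψ) = cong₂ _∨_ (evalF-ren r e φ) (evalF-ren r e ψ)
  evalF-ren r {ρ} {ρ'} e (exB t φ) rewrite evalT-ren r {ρ} {ρ'} e t =
    cong or (map-cong (λ x → evalF-ren (lift 1 r) (lift-env r {ρ} {ρ'} x e) φ) (upTo (suc (evalT t ρ X))))
  evalF-ren r {ρ} {ρ'} e (allB t φ) rewrite evalT-ren r {ρ} {ρ'} e t =
    cong and (map-cong (λ x → evalF-ren (lift 1 r) (lift-env r {ρ} {ρ'} x e) φ) (upTo (suc (evalT t ρ X))))

  evalT-wk : ∀ {ρ : Vec ℕ k} {x} t → evalT (wk t) (x ∷ ρ) X ≡ evalT t ρ X
  evalT-wk {ρ = ρ} {x} = evalT-ren suc {ρ} {x ∷ ρ} (λ _ → refl)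

  evalF-wk : ∀ {ρ : Vec ℕ k} {x} φ → evalF (wkF φ) (x ∷ ρ) X ≡ evalF φ ρ X
  evalF-wk {ρ = ρ} {x} = evalF-ren suc {ρ} {x ∷ ρ} (λ _ → refl)

  evalT-wks : ∀ {j} (xs : Vec ℕ j) {ρ : Vec ℕ k} t → evalT (wks j t) (xs ++ᵛ ρ) X ≡ evalT t ρ X
  evalT-wks []       t = refl
  evalT-wks {j = suc j} (x ∷ xs) {ρ} t = trans (evalT-wk {ρ = xs ++ᵛ ρ} {x} (wks j t)) (evalT-wks xs t)

  leq-reflects : ∀ (ρ : Vec ℕ k) t u {a b} → evalT t ρ X ≡ a → evalT u ρ X ≡ b → Reflects (a ≤ b) (evalF (leq t u) ρ X)
  leq-reflects ρ t u refl refl = ≤ᵇ-reflects-≤ _ _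

  eq-reflects : ∀ (ρ : Vec ℕ k) t u {a b} → evalT t ρ X ≡ a → evalT u ρ X ≡ b → Reflects (a ≡ b) (evalF (eq t u) ρ X)
  eq-reflects ρ t u refl refl = proof (evalT t ρ X ≟ evalT u ρ X)

  exB-reflects : ∀ (ρ : Vec ℕ k) t φ {m} {A : ℕ → Set} → evalT t ρ X ≡ m → (∀ x → Reflects (A x) (evalF φ (x ∷ ρ) X)) →
                 Reflects (∃ λ x → x ≤ m × A x) (evalF (exB t φ) ρ X)
  exB-reflects ρ t φ refl r = reflects-map (λ { (x , s≤s le , a) → x , le , a }) (λ { (x , le , a) → x , s≤s le , a })
                              (any-applyUpTo r id (suc (evalT t ρ X)))

  ∃<-reflects : ∀ (ρ : Vec ℕ k) t φ {A : Fin n → Set} → evalT t ρ X ≡ n →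
                (∀ x → Reflects (A x) (evalF φ (toℕ x ∷ ρ) X)) → Reflects (∃ A) (evalF (∃< t φ) ρ X)
  ∃<-reflects {n = n} ρ t φ {A} e r =
    reflects-map to from (exB-reflects ρ t (conj (leq (`1 ⊕ v0) (wk t)) φ) e (λ x →
      leq-reflects (x ∷ ρ) (`1 ⊕ v0) (wk t) refl (trans (evalT-wk t) e) ×-reflects reflects-true (evalF φ (x ∷ ρ) X)))
    where
    to : (∃ λ x → x ≤ n × x < n × evalF φ (x ∷ ρ) X ≡ true) → ∃ A
    to (x , _ , lt , h) = fromℕ< lt , reflects-elim (r (fromℕ< lt))
      (subst (λ y → evalF φ (y ∷ ρ) X ≡ true) (sym (toℕ-fromℕ< lt)) h)
    from : ∃ A → ∃ λ x → x ≤ n × x < n × evalF φ (x ∷ ρ) X ≡ true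
    from (x , a) = toℕ x , <⇒≤ (toℕ<n x) , toℕ<n x , reflects-yes (r x) a

  ∀<-reflects : ∀ (ρ : Vec ℕ k) t φ {A : Fin n → Set} → evalT t ρ X ≡ n →
                (∀ x → Reflects (A x) (evalF φ (toℕ x ∷ ρ) X)) → Reflects (∀ x → A x) (evalF (∀< t φ) ρ X)
  ∀<-reflects ρ t φ e r =
    reflects-map (λ none x → stable (r x) (λ ¬a → none (x , ¬a))) (λ all (x , ¬a) → ¬a (all x))
      (¬-reflects (∃<-reflects ρ t (neg φ) e (λ x → ¬-reflects (r x))))
    where
    stable : ∀ {B : Set} {b} → Reflects B b → ¬ ¬ B → B
    stable (ofʸ b)  _   = b
    stable (ofⁿ ¬b) ¬¬b = ⊥-elim (¬¬b ¬b)

  -- Only positions inside the string are constrained, so a code may have any bits beyond its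
  -- length; a run of equal bits is then described by a constant formula.
  record Repr (c : Code k) (ρ : Vec ℕ k) (S : Str) : Set where
    field
      lenOK  : length S ≡ evalT (len c) ρ X
      bitsOK : ∀ i → i < length S → bit S i ≡ evalF (bits c) (i ∷ ρ) X
  open Repr public

  module _ {ρ : Vec ℕ k} where

    tabulate-repr : ∀ {t φ} {f : Fin n → Bool} → evalT t ρ X ≡ n →
                    (∀ a → f a ≡ evalF φ (toℕ a ∷ ρ) X) → Repr ⟨ t , φ ⟩ ρ (tabulate f)
    lenOK (tabulate-repr {f = f} e h) = trans (length-tabulate f) (sym e)
    bitsOK (tabulate-repr {φ = φ} {f} e h) i lt =
      subst (λ j → bit (tabulate f) j ≡ evalF φ (j ∷ ρ) X) (toℕ-fromℕ< lt')
        (trans (bit-tabulate f (fromℕ< lt')) (h (fromℕ< lt')))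
      where lt' = subst (i <_) (length-tabulate f) lt

    replicate-repr : ∀ {t φ b} m → evalT t ρ X ≡ m → (∀ i → b ≡ evalF φ (i ∷ ρ) X) →
                     Repr ⟨ t , φ ⟩ ρ (replicate m b)
    lenOK (replicate-repr m e h) = trans (length-replicate m) (sym e)
    bitsOK (replicate-repr {φ = φ} {b} m e h) i lt = trans (bit-replicate m i lt) (h i)
      where
      bit-replicate : ∀ m i → i < length (replicate m b) → bit (replicate m b) i ≡ b
      bit-replicate (suc m) zero    _        = refl
      bit-replicate (suc m) (suc i) (s≤s lt) = bit-replicate m i lt

    single-repr : ∀ {φ b} → b ≡ evalF φ ρ X → Repr (single φ) ρ (b ∷ [])
    lenOK (single-repr h) = refl
    bitsOK (single-repr {φ} h) zero _ = trans h (sym (evalF-wk φ))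
    bitsOK (single-repr {φ} h) (suc i) (s≤s ())

    ⧺-repr : ∀ {c d S S'} → Repr c ρ S → Repr d ρ S' → Repr (c ⧺ d) ρ (S ++ S')
    lenOK (⧺-repr {S = S} r r') = trans (length-++ S) (cong₂ _+_ (lenOK r) (lenOK r'))
    -- Both Booleans are shown to reflect one proposition, hence they are equal. The same argument
    -- is used for the other compound formulas.
    bitsOK (⧺-repr {c} {d} {S} {S'} r r') i lt = det (reflects-true (bit (S ++ S') i))
      (reflects-map to from
        ((leq-reflects (i ∷ ρ) (`1 ⊕ v0) (wk (len c)) refl (trans (evalT-wk (len c)) (sym (lenOK r)))
            ×-reflects reflects-true (evalF (bits c) (i ∷ ρ) X))
        ⊎-reflects exB-reflects (i ∷ ρ) v0 (conj (eq v1 (wk (wk (len c)) ⊕ v0)) (renF (lift 1 suc) (bits d))) refl (λ j →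
            eq-reflects (j ∷ i ∷ ρ) v1 (wk (wk (len c)) ⊕ v0) refl
              (cong (_+ j) (trans (evalT-wk (wk (len c))) (trans (evalT-wk (len c)) (sym (lenOK r)))))
            ×-reflects reflects-true (evalF (renF (lift 1 suc) (bits d)) (j ∷ i ∷ ρ) X))))
      where
      tail-bit : ∀ j → evalF (renF (lift 1 suc) (bits d)) (j ∷ i ∷ ρ) X ≡ evalF (bits d) (j ∷ ρ) X
      tail-bit j = evalF-ren (lift 1 suc) (λ { zero → refl ; (suc _) → refl }) (bits d)

      in-tail : ∀ {j} → i ≡ length S + j → j < length S'
      in-tail e = +-cancelˡ-< (length S) _ _ (subst₂ _<_ e (length-++ S) lt)

      to : (i < length S × evalF (bits c) (i ∷ ρ) X ≡ true) ⊎
           (∃ λ j → j ≤ i × i ≡ length S + j × evalF (renF (lift 1 suc) (bits d)) (j ∷ i ∷ ρ) X ≡ true) →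
           bit (S ++ S') i ≡ true
      to (inj₁ (lt' , h)) = trans (bit-++ˡ S lt') (trans (bitsOK r i lt') h)
      to (inj₂ (j , _ , e , h)) = trans (cong (bit (S ++ S')) e)
        (trans (bit-++ʳ S j) (trans (bitsOK r' j (in-tail e)) (trans (sym (tail-bit j)) h)))

      from : bit (S ++ S') i ≡ true →
             (i < length S × evalF (bits c) (i ∷ ρ) X ≡ true) ⊎
             (∃ λ j → j ≤ i × i ≡ length S + j × evalF (renF (lift 1 suc) (bits d)) (j ∷ i ∷ ρ) X ≡ true)
      from h with i <? length S
      ... | yes lt' = inj₁ (lt' , trans (sym (bitsOK r i lt')) (trans (sym (bit-++ˡ S lt')) h))
      ... | no ge   = inj₂ (j , m∸n≤m i (length S) , e ,
              trans (tail-bit j) (trans (sym (bitsOK r' j (in-tail e)))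
                (trans (sym (bit-++ʳ S j)) (trans (cong (bit (S ++ S')) (sym e)) h))))
        where
        j = i ∸ length S
        e : i ≡ length S + j
        e = sym (m+[n∸m]≡n (≮⇒≥ ge))

    -- The quantified pair in `blocks` is a block index and an offset below the common width, hence
    -- the quotient and the remainder of the position. Division is available to exhibit this pair,
    -- though not as a term.
    blocks-repr : ∀ {t u c} {f : Fin n → Str} → evalT t ρ X ≡ n →
                  (∀ a → evalT (len c) (toℕ a ∷ ρ) X ≡ evalT u ρ X) →
                  (∀ a → Repr c (toℕ a ∷ ρ) (f a)) → Repr (blocks t u c) ρ (concat (tabulate f))
    blocks-repr {n} {t} {u} {c} {f} e w r = record { lenOK = len-ok ; bitsOK = bits-ok }
      where
      width = evalT u ρ X

      widths : ∀ a → length (f a) ≡ width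
      widths a = trans (lenOK (r a)) (w a)

      len-ok : length (concat (tabulate f)) ≡ evalT t ρ X * width
      len-ok = trans (length-blocks f widths) (cong (_* width) (sym e))

      body : ℕ → ℕ → ℕ → Bool
      body q' r' i = evalF (renF (lift 2 suc) (bits c)) (r' ∷ q' ∷ i ∷ ρ) X

      body-bit : ∀ q' r' i → body q' r' i ≡ evalF (bits c) (r' ∷ q' ∷ ρ) X
      body-bit q' r' i = evalF-ren (lift 2 suc) (λ { zero → refl ; (suc zero) → refl ; (suc (suc _)) → refl }) (bits c)

      bits-ok : ∀ i → i < length (concat (tabulate f)) →
                bit (concat (tabulate f)) i ≡ evalF (bits (blocks t u c)) (i ∷ ρ) X
      bits-ok i lt = det (reflects-true _) (reflects-map to from
        (exB-reflects (i ∷ ρ) v0 (exB v1 inner) {m = i} refl λ q' →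
         exB-reflects (q' ∷ i ∷ ρ) v1 inner {m = i} refl λ r' →
           eq-reflects (r' ∷ q' ∷ i ∷ ρ) v2 ((v1 ⊗ u₃) ⊕ v0) refl (cong (λ z → q' * z + r') (evalT-wks (r' ∷ q' ∷ i ∷ []) u))
           ×-reflects (leq-reflects (r' ∷ q' ∷ i ∷ ρ) (`1 ⊕ v0) u₃ refl (evalT-wks (r' ∷ q' ∷ i ∷ []) u)
           ×-reflects reflects-true (body q' r' i))))
        where
        u₃ = wk (wk (wk u))
        inner = conj (eq v2 ((v1 ⊗ u₃) ⊕ v0)) (conj (leq (`1 ⊕ v0) u₃) (renF (lift 2 suc) (bits c)))

        Split : Set
        Split = ∃ λ q' → q' ≤ i × ∃ λ r' → r' ≤ i × i ≡ q' * width + r' × r' < width × body q' r' i ≡ true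

        i<nw : i < n * width
        i<nw = subst (i <_) (length-blocks f widths) lt

        at : ∀ a r' → r' < width → i ≡ toℕ a * width + r' → bit (concat (tabulate f)) i ≡ body (toℕ a) r' i
        at a r' r'<w i≡ = trans (cong (bit (concat (tabulate f))) i≡)
          (trans (bit-blocks f widths a r'<w)
          (trans (bitsOK (r a) r' (subst (r' <_) (sym (widths a)) r'<w)) (sym (body-bit (toℕ a) r' i))))

        to : Split → bit (concat (tabulate f)) i ≡ true
        to (q' , _ , r' , _ , i≡ , r'<w , h) =
          trans (at a r' r'<w (trans i≡ (cong (λ z → z * width + r') (sym a≡q'))))
                (trans (cong (λ z → body z r' i) a≡q') h)
          where
          q'<n : q' < n
          q'<n = *-cancelʳ-< width q' n (≤-<-trans (subst (q' * width ≤_) (sym i≡) (m≤m+n _ r')) i<nw)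
          a = fromℕ< q'<n
          a≡q' = toℕ-fromℕ< q'<n

        from : bit (concat (tabulate f)) i ≡ true → Split
        from h = i / width , m/n≤m i width , i % width , m%n≤m i width , i≡ , m%n<n i width ,
          trans (cong (λ z → body z (i % width) i) (sym a≡q)) (trans (sym (at a (i % width) (m%n<n i width)
            (trans i≡ (cong (λ z → z * width + i % width) (sym a≡q))))) h)
          where
          -- A position below `n * width` exists, which rules out width 0 and permits the division.
          instance
            width≢0 : NonZero width
            width≢0 = m*n≢0⇒n≢0 n {{>-nonZero (≤-<-trans z≤n i<nw)}}
          i≡ : i ≡ i / width * width + i % width
          i≡ = trans (m≡m%n+[m/n]*n i width) (+-comm (i % width) _)
          q<n = m<n*o⇒m/o<n {i} {n} {width} i<nw
          a = fromℕ< q<n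
          a≡q = toℕ-fromℕ< q<n

    unary-repr : ∀ {t m} → evalT t ρ X ≡ m → Repr (unaryC t) ρ (unary m)
    unary-repr {t} {m} e = ⧺-repr (replicate-repr m e (λ _ → refl)) (single-repr {φ = falseF} refl)

-- String functions defined through guessed parameters

ex3 : Form (3 + k) → Form k
ex3 φ = exB ∣X∣ (exB ∣X∣ (exB ∣X∣ φ))

ex3-reflects : ∀ X (ρ : Vec ℕ k) φ {A : ℕ → ℕ → ℕ → Set} →
  (∀ n a b → Reflects (A n a b) (evalF φ (n ∷ a ∷ b ∷ ρ) X)) →
  Reflects (∃ λ b → b ≤ length X × ∃ λ a → a ≤ length X × ∃ λ n → n ≤ length X × A n a b) (evalF (ex3 φ) ρ X)
ex3-reflects X ρ φ r =
  exB-reflects ρ ∣X∣ (exB ∣X∣ (exB ∣X∣ φ)) refl λ b →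
  exB-reflects (b ∷ ρ) ∣X∣ (exB ∣X∣ φ) refl λ a →
  exB-reflects (a ∷ b ∷ ρ) ∣X∣ φ refl λ n → r n a b
  where open Semantics X

-- The decision procedure is the evaluation of the bounded formula `ex3 V`; the size hypothesis
-- makes the bounds lossless.
satisfiable? : ∀ (V : Form 3) X →
  (∀ n a b → evalF V (n ∷ a ∷ b ∷ []) X ≡ true → n ≤ length X × a ≤ length X × b ≤ length X) →
  Dec (∃ λ n → ∃ λ a → ∃ λ b → evalF V (n ∷ a ∷ b ∷ []) X ≡ true)
satisfiable? V X small = record { does = _ ; proof = reflects-map
  (λ { (b , _ , a , _ , n , _ , h) → n , a , b , h })
  (λ { (n , a , b , h) → let (n≤ , a≤ , b≤) = small n a b h in b , b≤ , a , a≤ , n , n≤ , h })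
  (ex3-reflects X [] V (λ n a b → reflects-true _)) }

-- Terms are monotone, so putting ∣X∣ for each variable bounds the value at all parameters up to ∣X∣
-- by a closed term.
close : Term k → Term 0
close (var i) = ∣X∣
close `0      = `0
close `1      = `1
close (t ⊕ u) = close t ⊕ close u
close (t ⊗ u) = close t ⊗ close u
close ∣X∣     = ∣X∣

close-bound : ∀ X {ρ : Vec ℕ k} → (∀ i → vlookup ρ i ≤ length X) → ∀ t → evalT t ρ X ≤ evalT (close t) [] X
close-bound X le (var i) = le i
close-bound X le `0      = z≤n
close-bound X le `1      = ≤-refl
close-bound X le (t ⊕ u) = +-mono-≤ (close-bound X le t) (close-bound X le u)
close-bound X le (t ⊗ u) = *-mono-≤ (close-bound X le t) (close-bound X le u)
close-bound X le ∣X∣     = ≤-refl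

-- The parameters need not be unique here: `on` asks that the code describe `F X` at every triple
-- satisfying `V`, so each guess yields the same length and the same bits.
module _ (V : Form 3) (c : Code 3) (F : Str → Str)
  (small : ∀ X n a b → evalF V (n ∷ a ∷ b ∷ []) X ≡ true → n ≤ length X × a ≤ length X × b ≤ length X)
  (on    : ∀ X n a b → evalF V (n ∷ a ∷ b ∷ []) X ≡ true → Semantics.Repr X c (n ∷ a ∷ b ∷ []) (F X))
  (off   : ∀ X → (∀ n a b → evalF V (n ∷ a ∷ b ∷ []) X ≢ true) → F X ≡ []) where

  private
    Witness : Str → Set
    Witness X = ∃ λ n → ∃ λ a → ∃ λ b → evalF V (n ∷ a ∷ b ∷ []) X ≡ true

    witness? : ∀ X → Dec (Witness X)
    witness? X = satisfiable? V X (small X)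

    outer : Fin 3 → Fin 4
    outer i = i ↑ˡ 1

    -- (i , n , a , b) ↦ (n , a , b , i)
    rotate : Fin 4 → Fin 4
    rotate zero    = suc (suc (suc zero))
    rotate (suc i) = i ↑ˡ 1

    V⁺ : Form 4
    V⁺ = renF outer V

    lenF : Form 1
    lenF = disj (ex3 (conj V⁺ (eq v3 (renT outer (len c))))) (conj (neg (ex3 V⁺)) (eq v0 `0))

    -- No clause for unsuitable strings: there `F X` is empty and has no positions.
    bitF : Form 1
    bitF = ex3 (conj V⁺ (renF rotate (bits c)))

    module _ (X : Str) (y n a b : ℕ) where
      open Semantics X
      outer-env : ∀ i → vlookup (n ∷ a ∷ b ∷ y ∷ []) (outer i) ≡ vlookup (n ∷ a ∷ b ∷ []) i
      outer-env zero             = refl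
      outer-env (suc zero)       = refl
      outer-env (suc (suc zero)) = refl

      rotate-env : ∀ i → vlookup (n ∷ a ∷ b ∷ y ∷ []) (rotate i) ≡ vlookup (y ∷ n ∷ a ∷ b ∷ []) i
      rotate-env zero    = refl
      rotate-env (suc i) = outer-env i

      V⁺-reflects : Reflects (evalF V (n ∷ a ∷ b ∷ []) X ≡ true) (evalF V⁺ (n ∷ a ∷ b ∷ y ∷ []) X)
      V⁺-reflects = subst (Reflects _) (sym (evalF-ren outer outer-env V)) (reflects-true _)

      lenEq-reflects : Reflects (y ≡ evalT (len c) (n ∷ a ∷ b ∷ []) X)
        (evalF (eq v3 (renT outer (len c))) (n ∷ a ∷ b ∷ y ∷ []) X)
      lenEq-reflects = eq-reflects (n ∷ a ∷ b ∷ y ∷ []) v3 (renT outer (len c)) refl (evalT-ren outer outer-env (len c))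

    lenF-reflects : ∀ X y → Reflects (y ≡ length (F X)) (evalF lenF (y ∷ []) X)
    lenF-reflects X y = reflects-map to from
      (ex3-reflects X (y ∷ []) (conj V⁺ (eq v3 (renT outer (len c))))
         (λ n a b → V⁺-reflects X y n a b ×-reflects lenEq-reflects X y n a b)
       ⊎-reflects (¬-reflects (ex3-reflects X (y ∷ []) V⁺ (λ n a b → V⁺-reflects X y n a b))
         ×-reflects eq-reflects (y ∷ []) v0 `0 refl refl))
      where
      open Semantics X
      Some = ∃ λ b → b ≤ length X × ∃ λ a → a ≤ length X × ∃ λ n → n ≤ length X ×
        (evalF V (n ∷ a ∷ b ∷ []) X ≡ true × y ≡ evalT (len c) (n ∷ a ∷ b ∷ []) X)
      None = ¬ (∃ λ b → b ≤ length X × ∃ λ a → a ≤ length X × ∃ λ n → n ≤ length X ×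
        evalF V (n ∷ a ∷ b ∷ []) X ≡ true) × y ≡ 0

      to : Some ⊎ None → y ≡ length (F X)
      to (inj₁ (b , _ , a , _ , n , _ , h , e)) = trans e (sym (lenOK (on X n a b h)))
      to (inj₂ (none , refl)) = sym (cong length (off X λ n a b h →
        let (n≤ , a≤ , b≤) = small X n a b h in none (b , b≤ , a , a≤ , n , n≤ , h)))

      from : y ≡ length (F X) → Some ⊎ None
      from e with witness? X
      ... | yes (n , a , b , h) = let (n≤ , a≤ , b≤) = small X n a b h in
              inj₁ (b , b≤ , a , a≤ , n , n≤ , h , trans e (lenOK (on X n a b h)))
      ... | no none = inj₂ ((λ { (b , _ , a , _ , n , _ , h) → none (n , a , b , h) }) ,
              trans e (cong length (off X λ n a b h → none (n , a , b , h))))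

    bitF-reflects : ∀ X i → i < length (F X) → Reflects (bit (F X) i ≡ true) (evalF bitF (i ∷ []) X)
    bitF-reflects X i lt = reflects-map to from
      (ex3-reflects X (i ∷ []) (conj V⁺ (renF rotate (bits c)))
        (λ n a b → V⁺-reflects X i n a b ×-reflects
          subst (Reflects _) (sym (evalF-ren rotate (rotate-env X i n a b) (bits c))) (reflects-true _)))
      where
      open Semantics X
      Some = ∃ λ b → b ≤ length X × ∃ λ a → a ≤ length X × ∃ λ n → n ≤ length X ×
        (evalF V (n ∷ a ∷ b ∷ []) X ≡ true × evalF (bits c) (i ∷ n ∷ a ∷ b ∷ []) X ≡ true)

      to : Some → bit (F X) i ≡ true
      to (b , _ , a , _ , n , _ , h , e) = trans (bitsOK (on X n a b h) i lt) e

      from : bit (F X) i ≡ true → Some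
      from e with witness? X
      ... | yes (n , a , b , h) = let (n≤ , a≤ , b≤) = small X n a b h in
              b , b≤ , a , a≤ , n , n≤ , h , trans (sym (bitsOK (on X n a b h) i lt)) e
      ... | no none with () ← subst (λ S → i < length S) (off X λ n a b h → none (n , a , b , h)) lt

  ac0-by-cases : IsAC0 F
  ac0-by-cases = record
    { bound    = close (len c)
    ; bounded  = bounded
    ; lenDef   = lenF
    ; lenDefOK = λ X y → mk⇔ (reflects-elim (lenF-reflects X y)) (reflects-yes (lenF-reflects X y))
    ; bitDef   = bitF
    ; bitDefOK = λ X i lt → det (reflects-true _) (bitF-reflects X i lt) }
    where
    bounded : ∀ X → length (F X) ≤ evalT (close (len c)) [] X
    bounded X with witness? X
    ... | no none = subst (λ S → length S ≤ _) (sym (off X λ n a b h → none (n , a , b , h))) z≤n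
    ... | yes (n , a , b , h) =
            subst (_≤ _) (sym (Semantics.lenOK (on X n a b h))) (close-bound X le (len c))
      where
      le : ∀ i → vlookup (n ∷ a ∷ b ∷ []) i ≤ length X
      le zero             = proj₁ (small X n a b h)
      le (suc zero)       = proj₁ (proj₂ (small X n a b h))
      le (suc (suc zero)) = proj₂ (proj₂ (small X n a b h))

-- Preferences read from the input string

-- Inverts `enc3` placed at offset `off`. It is defined for all strings and numbers, as bits outside
-- the string are false, so preferences can be read before it is known whether the string is an
-- instance.
read : Str → (n off : ℕ) → Pref n
read X n off a x y = bit X (off + (toℕ a * (n * n) + (toℕ x * n + toℕ y)))

prefF : (n off a x y : Term k) → Form k
prefF n off a x y = mem (off ⊕ ((a ⊗ (n ⊗ n)) ⊕ ((x ⊗ n) ⊕ y)))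

firstF : (n off a x : Term k) → Form k
firstF n off a x = ∀< n (neg (prefF (wk n) (wk off) (wk a) v0 (wk x)))

nextF : (n off a x y : Term k) → Form k
nextF n off a x y = conj (prefF n off a x y)
  (∀< n (neg (conj (prefF (wk n) (wk off) (wk a) (wk x) v0) (prefF (wk n) (wk off) (wk a) v0 (wk y)))))

irreflF transF totalF strictF : (n off : Term k) → Form k
irreflF n off = ∀< n (∀< (wk n) (neg (prefF (wks 2 n) (wks 2 off) v1 v0 v0)))
transF n off = ∀< n (∀< (wk n) (∀< (wks 2 n) (∀< (wks 3 n)
  (disj (neg (prefF (wks 4 n) (wks 4 off) v3 v2 v1))
  (disj (neg (prefF (wks 4 n) (wks 4 off) v3 v1 v0)) (prefF (wks 4 n) (wks 4 off) v3 v2 v0))))))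
totalF n off = ∀< n (∀< (wk n) (∀< (wks 2 n)
  -- The double negation is kept: it is literally the implication from x ≢ y, so the proof of
  -- reflection follows the formula.
  (disj (neg (neg (eq v1 v0)))
  (disj (prefF (wks 3 n) (wks 3 off) v2 v1 v0) (prefF (wks 3 n) (wks 3 off) v2 v0 v1)))))
strictF n off = conj (irreflF n off) (conj (transF n off) (totalF n off))

enc3C : (n off : Term k) → Code k
enc3C n off = blocks n (n ⊗ n) (blocks (wk n) (wk n)
  ⟨ wks 2 n , prefF (wks 3 n) (wks 3 off) v2 v1 v0 ⟩)

module Preferences (X : Str) where
  open Semantics X

  pref-eval : ∀ (ρ : Vec ℕ k) {tn toff ta tx ty off} {a x y : Fin n} →
    evalT tn ρ X ≡ n → evalT toff ρ X ≡ off → evalT ta ρ X ≡ toℕ a → evalT tx ρ X ≡ toℕ x → evalT ty ρ X ≡ toℕ y →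
    read X n off a x y ≡ evalF (prefF tn toff ta tx ty) ρ X
  pref-eval ρ en eo ea ex ey = cong (bit X) (sym (cong₂ _+_ eo
    (cong₂ _+_ (cong₂ _*_ ea (cong₂ _*_ en en)) (cong₂ _+_ (cong₂ _*_ ex en) ey))))

  module _ (ρ : Vec ℕ k) {tn toff : Term k} {off : ℕ} (en : evalT tn ρ X ≡ n) (eo : evalT toff ρ X ≡ off) where

    private
      p : Pref n
      p = read X n off

    pref-reflects : ∀ {j} (xs : Vec ℕ j) {ta tx ty} {a x y : Fin n} →
      evalT ta (xs ++ᵛ ρ) X ≡ toℕ a → evalT tx (xs ++ᵛ ρ) X ≡ toℕ x → evalT ty (xs ++ᵛ ρ) X ≡ toℕ y →
      Reflects (p a x y ≡ true) (evalF (prefF (wks j tn) (wks j toff) ta tx ty) (xs ++ᵛ ρ) X)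
    pref-reflects xs {ta} {tx} {ty} ea ex ey = subst (Reflects _)
      (pref-eval (xs ++ᵛ ρ) {wks _ tn} {wks _ toff} {ta} {tx} {ty} (trans (evalT-wks xs tn) en) (trans (evalT-wks xs toff) eo) ea ex ey)
      (reflects-true _)

    first-reflects : ∀ ta tx {a x : Fin n} → evalT ta ρ X ≡ toℕ a → evalT tx ρ X ≡ toℕ x →
      Reflects (First p a x) (evalF (firstF tn toff ta tx) ρ X)
    first-reflects ta tx ea ex = ∀<-reflects ρ tn (neg (prefF (wk tn) (wk toff) (wk ta) v0 (wk tx))) en λ z →
      ¬-reflects (pref-reflects (toℕ z ∷ []) {wk ta} {v0} {wk tx} (trans (evalT-wk ta) ea) refl (trans (evalT-wk tx) ex))

    next-reflects : ∀ ta tx ty {a x y : Fin n} → evalT ta ρ X ≡ toℕ a → evalT tx ρ X ≡ toℕ x → evalT ty ρ X ≡ toℕ y →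
      Reflects (Next p a x y) (evalF (nextF tn toff ta tx ty) ρ X)
    next-reflects ta tx ty ea ex ey = pref-reflects [] {ta} {tx} {ty} ea ex ey ×-reflects
      ∀<-reflects ρ tn
        (neg (conj (prefF (wk tn) (wk toff) (wk ta) (wk tx) v0) (prefF (wk tn) (wk toff) (wk ta) v0 (wk ty)))) en λ z →
        ¬-reflects (pref-reflects (toℕ z ∷ []) {wk ta} {wk tx} {v0} (trans (evalT-wk ta) ea) (trans (evalT-wk tx) ex) refl
          ×-reflects pref-reflects (toℕ z ∷ []) {wk ta} {v0} {wk ty} (trans (evalT-wk ta) ea) refl (trans (evalT-wk ty) ey))

    private
      ∀<′ : ∀ {j} (xs : Vec ℕ j) φ {A : Fin n → Set} →
            (∀ x → Reflects (A x) (evalF φ (toℕ x ∷ (xs ++ᵛ ρ)) X)) →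
            Reflects (∀ x → A x) (evalF (∀< (wks j tn) φ) (xs ++ᵛ ρ) X)
      ∀<′ xs φ = ∀<-reflects (xs ++ᵛ ρ) (wks _ tn) φ (trans (evalT-wks xs tn) en)

      irreflR : Reflects (∀ a x → p a x x ≡ false) (evalF (irreflF tn toff) ρ X)
      irreflR = ∀<′ [] (∀< (wk tn) φ) λ a → ∀<′ (toℕ a ∷ []) φ λ x →
        reflects-map ¬-not not-¬ (¬-reflects (pref-reflects (toℕ x ∷ toℕ a ∷ []) {v1} {v0} {v0} refl refl refl))
        where φ = neg (prefF (wks 2 tn) (wks 2 toff) v1 v0 v0)

      transR : Reflects (∀ a x y z → p a x y ≡ true → p a y z ≡ true → p a x z ≡ true) (evalF (transF tn toff) ρ X)
      transR = ∀<′ [] φ₁ λ a → ∀<′ (toℕ a ∷ []) φ₂ λ x → ∀<′ (toℕ x ∷ toℕ a ∷ []) φ₃ λ y →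
               ∀<′ (toℕ y ∷ toℕ x ∷ toℕ a ∷ []) φ₄ λ z → let xs = toℕ z ∷ toℕ y ∷ toℕ x ∷ toℕ a ∷ [] in
        pref-reflects xs {v3} {v2} {v1} refl refl refl →-reflects
        (pref-reflects xs {v3} {v1} {v0} refl refl refl →-reflects pref-reflects xs {v3} {v2} {v0} refl refl refl)
        where
        φ₄ = disj (neg (prefF (wks 4 tn) (wks 4 toff) v3 v2 v1))
             (disj (neg (prefF (wks 4 tn) (wks 4 toff) v3 v1 v0)) (prefF (wks 4 tn) (wks 4 toff) v3 v2 v0))
        φ₃ = ∀< (wks 3 tn) φ₄
        φ₂ = ∀< (wks 2 tn) φ₃
        φ₁ = ∀< (wk tn) φ₂

      totalR : Reflects (∀ a x y → x ≢ y → p a x y ≡ true ⊎ p a y x ≡ true) (evalF (totalF tn toff) ρ X)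
      totalR = ∀<′ [] φ₁ λ a → ∀<′ (toℕ a ∷ []) φ₂ λ x → ∀<′ (toℕ x ∷ toℕ a ∷ []) φ₃ λ y →
               let xs = toℕ y ∷ toℕ x ∷ toℕ a ∷ [] in
        reflects-map (λ h ne → h (ne ∘ toℕ-injective)) (λ h ne → h (ne ∘ cong toℕ))
        (¬-reflects (eq-reflects (xs ++ᵛ ρ) v1 v0 refl refl) →-reflects
        (pref-reflects xs {v2} {v1} {v0} refl refl refl ⊎-reflects pref-reflects xs {v2} {v0} {v1} refl refl refl))
        where
        φ₃ = disj (neg (neg (eq v1 v0)))
             (disj (prefF (wks 3 tn) (wks 3 toff) v2 v1 v0) (prefF (wks 3 tn) (wks 3 toff) v2 v0 v1))
        φ₂ = ∀< (wks 2 tn) φ₃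
        φ₁ = ∀< (wk tn) φ₂

    strict-reflects : Reflects (StrictTotalRows p) (evalF (strictF tn toff) ρ X)
    strict-reflects = irreflR ×-reflects (transR ×-reflects totalR)

    enc3-repr : Repr (enc3C tn toff) ρ (enc3 n p)
    enc3-repr = blocks-repr en (λ a → cong₂ _*_ (evalT-wk tn) (evalT-wk tn)) λ a →
      blocks-repr (trans (evalT-wk tn) en) (λ b → evalT-wk (wk tn)) λ b →
      tabulate-repr (trans (evalT-wks (toℕ b ∷ toℕ a ∷ []) tn) en) λ c →
      pref-eval (toℕ c ∷ toℕ b ∷ toℕ a ∷ ρ) {wks 3 tn} {wks 3 toff} {v2} {v1} {v0}
        (trans (evalT-wks (toℕ c ∷ toℕ b ∷ toℕ a ∷ []) tn) en) (trans (evalT-wks (toℕ c ∷ toℕ b ∷ toℕ a ∷ []) toff) eo)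
        refl refl refl

-- The network as a string

eqFin-reflects : ∀ (a i : Fin n) → Reflects (toℕ a ≡ toℕ i) (eqFin a i)
eqFin-reflects a i = reflects-map (cong toℕ) toℕ-injective
  (subst (Reflects _) (sym (isYes≗does (a ≟F i))) (proof (a ≟F i)))

concatMap-concat : ∀ {A B : Set} (f : A → List B) {n} (xss : Fin n → List A) →
  concatMap f (concat (tabulate xss)) ≡ concat (tabulate (λ a → concatMap f (xss a)))
concatMap-concat f {zero}  xss = refl
concatMap-concat f {suc n} xss = trans (concatMap-++ f (xss zero) _)
  (cong (concatMap f (xss zero) ++_) (concatMap-concat f (xss ∘ suc)))

hotF : Term k → Form (suc k)
hotF t = eq v0 (wk t)

gateC : Term k → Form k → Form (suc k) → Form (suc k) → Code k
gateC N type hot₁ hot₂ = single type ⧺ ⟨ N , hot₁ ⟩ ⧺ ⟨ N , hot₂ ⟩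

cmpC : (N i j : Term k) → Code k
cmpC N i j = gateC N falseF (hotF i) (hotF j)

cmpIfC : Term k → Form k → (i j : Term k) → Code k
cmpIfC N c i j = gateC N falseF (hotF i) (disj (conj (wkF c) (hotF j)) (conj (neg (wkF c)) (hotF i)))

ngtC : (N i : Term k) → Code k
ngtC N i = gateC N trueF (hotF i) falseF

-- The condition itself is the type bit. When it fails the gate is a comparator of `i` with itself,
-- so the second field repeats the first instead of being zero.
ngtIfC : Term k → Form k → Term k → Code k
ngtIfC N c i = gateC N c (hotF i) (conj (neg (wkF c)) (hotF i))

-- Bracketed like the lengths of the codes below, so that each condition on block widths reduces to
-- `n` having the same value in two environments.
roundsT wiresT gateT cellT rowT : Term k → Term k
roundsT n = `2 ⊗ (n ⊗ n)
wiresT n = (`1 ⊕ roundsT n) ⊗ (`2 ⊗ (n ⊗ n))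
gateT n = `1 ⊕ (wiresT n ⊕ wiresT n)
cellT n = n ⊗ gateT n
rowT n = n ⊗ cellT n

wireT : (n k s x y : Term m) → Term m
wireT n k s x y = (((`2 ⊗ (n ⊗ n)) ⊗ k) ⊕ (((n ⊗ n) ⊗ s) ⊕ ((n ⊗ x) ⊕ y)))

-- Under a loop over the rounds, variable 0 being the round.
comparisonsC : Term k → Code (suc k)
comparisonsC n = blocks (wk n) (cellT (wk n)) (blocks (wks 2 n) (gateT (wks 2 n))
  (cmpC (wiresT (wks 3 n)) (wireT (wks 3 n) v2 `0 v1 v0) (wireT (wks 3 n) v2 `1 v0 v1)))

movesC : (n off s : Term k) → Code (suc k)
movesC n off s = blocks (wk n) (rowT (wk n)) (blocks (wks 2 n) (cellT (wks 2 n)) (blocks (wks 3 n) (gateT (wks 3 n))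
  (cmpIfC (wiresT (wks 4 n)) (nextF (wks 4 n) (wks 4 off) v2 v1 v0)
    (wireT (wks 4 n) v3 (wks 4 s) v2 v1) (wireT (wks 4 n) (`1 ⊕ v3) (wks 4 s) v2 v0))))

sourcesC : (n off : Term k) → Code (suc k)
sourcesC n off = blocks (wk n) (cellT (wk n)) (blocks (wks 2 n) (gateT (wks 2 n))
  (ngtIfC (wiresT (wks 3 n)) (firstF (wks 3 n) (wks 3 off) v1 v0) (wireT (wks 3 n) (`1 ⊕ v2) `0 v1 v0)))

layerC : (n offP offR : Term k) → Code (suc k)
layerC n offP offR = comparisonsC n ⧺ movesC n offP `0 ⧺ movesC n offR `1 ⧺ sourcesC n offP

-- Comparisons and sources take n² gates each, the two families of moves n³ each.
layerT : Term k → Term k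
layerT n = rowT n ⊕ ((n ⊗ rowT n) ⊕ ((n ⊗ rowT n) ⊕ rowT n))

readoutC : (n a b : Term k) → Code k
readoutC n a b = ngtC (wiresT n) (wireT n (roundsT n) `1 b a) ⧺
                 cmpC (wiresT n) (wireT n (roundsT n) `0 a b) (wireT n (roundsT n) `1 b a)

networkC : (n offP offR a b : Term k) → Code k
networkC n offP offR a b = unaryC (wiresT n) ⧺ unaryC (wireT n (roundsT n) `0 a b) ⧺ ⟨ wiresT n , falseF ⟩ ⧺
  blocks (roundsT n) (layerT n) (layerC n offP offR) ⧺ readoutC n a b

module Gates (X : Str) where
  open Semantics X
  open Preferences X

  module _ {ρ : Vec ℕ k} {tN : Term k} (eN : evalT tN ρ X ≡ N) where

    hot-eval : ∀ {t} {i : Fin N} → evalT t ρ X ≡ toℕ i → ∀ a → eqFin a i ≡ evalF (hotF t) (toℕ a ∷ ρ) X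
    hot-eval {t} {i} e a = det (eqFin-reflects a i) (eq-reflects (toℕ a ∷ ρ) v0 (wk t) refl (trans (evalT-wk t) e))

    oneHot-repr : ∀ {t} {i : Fin N} → evalT t ρ X ≡ toℕ i → Repr ⟨ tN , hotF t ⟩ ρ (oneHot N i)
    oneHot-repr {t} e = tabulate-repr eN (hot-eval {t} e)

    cmp-repr : ∀ {ti tj} {i j : Fin N} → evalT ti ρ X ≡ toℕ i → evalT tj ρ X ≡ toℕ j →
               Repr (cmpC tN ti tj) ρ (encGate (cmp i j))
    cmp-repr ei ej = ⧺-repr (single-repr refl) (⧺-repr (oneHot-repr ei) (oneHot-repr ej))

    ngt-repr : ∀ {ti} {i : Fin N} → evalT ti ρ X ≡ toℕ i → Repr (ngtC tN ti) ρ (encGate (ngt i))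
    ngt-repr ei = ⧺-repr (single-repr refl) (⧺-repr (oneHot-repr ei) (replicate-repr N eN (λ _ → refl)))

    cmpIf-repr : ∀ {c ti tj b} {i j : Fin N} → b ≡ evalF c ρ X → evalT ti ρ X ≡ toℕ i → evalT tj ρ X ≡ toℕ j →
                 Repr (cmpIfC tN c ti tj) ρ (encGate (cmpIf b i j))
    cmpIf-repr {c} {ti} {tj} {b} {i} {j} ec ei ej =
      ⧺-repr (single-repr refl) (⧺-repr (oneHot-repr ei) (tabulate-repr eN (choice b ec)))
      where
      choice : ∀ b → b ≡ evalF c ρ X → ∀ a → eqFin a (if b then j else i) ≡
               evalF (disj (conj (wkF c) (hotF tj)) (conj (neg (wkF c)) (hotF ti))) (toℕ a ∷ ρ) X
      choice true  e a rewrite trans (evalF-wk {ρ = ρ} {x = toℕ a} c) (sym e) =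
        trans (hot-eval {tj} ej a) (sym (∨-identityʳ _))
      choice false e a rewrite trans (evalF-wk {ρ = ρ} {x = toℕ a} c) (sym e) = hot-eval {ti} ei a

    ngtIf-repr : ∀ {c ti b} {i : Fin N} → b ≡ evalF c ρ X → evalT ti ρ X ≡ toℕ i →
                 Repr (ngtIfC tN c ti) ρ (encGate (ngtIf b i))
    ngtIf-repr {c} {ti} {true} {i} ec ei =
      ⧺-repr (single-repr ec) (⧺-repr (oneHot-repr ei) (replicate-repr N eN unset))
      where
      unset : ∀ q → false ≡ evalF (conj (neg (wkF c)) (hotF ti)) (q ∷ ρ) X
      unset q rewrite trans (evalF-wk {ρ = ρ} {x = q} c) (sym ec) = refl
    ngtIf-repr {c} {ti} {false} {i} ec ei =
      ⧺-repr (single-repr ec) (⧺-repr (oneHot-repr ei) (tabulate-repr eN set))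
      where
      set : ∀ a → eqFin a i ≡ evalF (conj (neg (wkF c)) (hotF ti)) (toℕ a ∷ ρ) X
      set a rewrite trans (evalF-wk {ρ = ρ} {x = toℕ a} c) (sym ec) = hot-eval {ti} ei a

  ReprG : Code k → Vec ℕ k → List (Gate N) → Set
  ReprG c ρ gs = Repr c ρ (concatMap encGate gs)

  gate-reprG : ∀ {ρ : Vec ℕ k} {c} (g : Gate N) → Repr c ρ (encGate g) → ReprG c ρ (g ∷ [])
  gate-reprG {ρ = ρ} {c} g = subst (Repr c ρ) (sym (++-identityʳ (encGate g)))

  ⧺-reprG : ∀ {ρ : Vec ℕ k} {c d} {gs hs : List (Gate N)} → ReprG c ρ gs → ReprG d ρ hs → ReprG (c ⧺ d) ρ (gs ++ hs)
  ⧺-reprG {ρ = ρ} {c} {d} {gs} {hs} r r' = subst (Repr (c ⧺ d) ρ) (sym (concatMap-++ encGate gs hs)) (⧺-repr r r')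

  blocks-reprG : ∀ {ρ : Vec ℕ k} {t u c} {gss : Fin n → List (Gate N)} → evalT t ρ X ≡ n →
                 (∀ a → evalT (len c) (toℕ a ∷ ρ) X ≡ evalT u ρ X) →
                 (∀ a → ReprG c (toℕ a ∷ ρ) (gss a)) → ReprG (blocks t u c) ρ (concat (tabulate gss))
  blocks-reprG {ρ = ρ} {t} {u} {c} {gss} e w r =
    subst (Repr (blocks t u c) ρ) (sym (concatMap-concat encGate gss)) (blocks-repr e w r)

  module _ (ρ : Vec ℕ k) {tn tP tR : Term k} {offP offR : ℕ}
           (en : evalT tn ρ X ≡ n) (eP : evalT tP ρ X ≡ offP) (eR : evalT tR ρ X ≡ offR) where

    private
      mp wp : Pref n
      mp = read X n offP
      wp = read X n offR
    open Network mp wp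
    open DeferredAcceptance mp wp using (rounds)

    private
      at : ∀ {j} (xs : Vec ℕ j) → evalT (wks j tn) (xs ++ᵛ ρ) X ≡ n
      at xs = trans (evalT-wks xs tn) en

      gateN cellN rowN wiresN : ℕ → ℕ
      wiresN z = suc (2 * (z * z)) * (2 * (z * z))
      gateN z = suc (wiresN z + wiresN z)
      cellN z = z * gateN z
      rowN z = z * cellN z

      same : ∀ {j j'} (f : ℕ → ℕ) (xs : Vec ℕ j) (ys : Vec ℕ j') →
             f (evalT (wks j tn) (xs ++ᵛ ρ) X) ≡ f (evalT (wks j' tn) (ys ++ᵛ ρ) X)
      same f xs ys = cong f (trans (at xs) (sym (at ys)))

      wire-eval : ∀ {j} (xs : Vec ℕ j) {tk ts tx ty i s x y} →
        evalT tk (xs ++ᵛ ρ) X ≡ toℕ i → evalT ts (xs ++ᵛ ρ) X ≡ toℕ s →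
        evalT tx (xs ++ᵛ ρ) X ≡ toℕ x → evalT ty (xs ++ᵛ ρ) X ≡ toℕ y →
        evalT (wireT (wks j tn) tk ts tx ty) (xs ++ᵛ ρ) X ≡ toℕ (wire i s x y)
      wire-eval xs {i = i} {s} {x} {y} ek es ex ey = trans
        (cong₂ _+_ (cong₂ _*_ (cong (λ z → 2 * (z * z)) (at xs)) ek)
          (cong₂ _+_ (cong₂ _*_ (cong (λ z → z * z) (at xs)) es) (cong₂ _+_ (cong₂ _*_ (at xs) ex) ey)))
        (sym (toℕ-wire i s x y))

      wires-eval : ∀ {j} (xs : Vec ℕ j) → evalT (wiresT (wks j tn)) (xs ++ᵛ ρ) X ≡ wires
      wires-eval xs = cong wiresN (at xs)

    comparisons-repr : ∀ i → ReprG (comparisonsC tn) (toℕ i ∷ ρ) (comparisons i)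
    comparisons-repr i =
      blocks-reprG (at (toℕ i ∷ [])) (λ x → same cellN (toℕ x ∷ toℕ i ∷ []) (toℕ i ∷ [])) λ x →
      blocks-reprG (at (toℕ x ∷ toℕ i ∷ [])) (λ y → same gateN (toℕ y ∷ toℕ x ∷ toℕ i ∷ []) (toℕ x ∷ toℕ i ∷ [])) λ y →
      let xs = toℕ y ∷ toℕ x ∷ toℕ i ∷ [] in
      gate-reprG (cmp (wire (inject₁ i) zero x y) (wire (inject₁ i) (suc zero) y x)) (cmp-repr (wires-eval xs)
        (wire-eval xs {v2} {`0} {v1} {v0} (sym (toℕ-inject₁ i)) refl refl refl)
        (wire-eval xs {v2} {`1} {v0} {v1} (sym (toℕ-inject₁ i)) refl refl refl))

    moves-repr : ∀ {ts toff off s} → evalT ts ρ X ≡ toℕ s → evalT toff ρ X ≡ off → ∀ i →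
                 ReprG (movesC tn toff ts) (toℕ i ∷ ρ) (moves s (read X n off) i)
    moves-repr {ts} {toff} {off} {s} es eo i =
      blocks-reprG (at (toℕ i ∷ [])) (λ x → same rowN (toℕ x ∷ toℕ i ∷ []) (toℕ i ∷ [])) λ x →
      blocks-reprG (at (toℕ x ∷ toℕ i ∷ [])) (λ y → same cellN (toℕ y ∷ toℕ x ∷ toℕ i ∷ []) (toℕ x ∷ toℕ i ∷ [])) λ y →
      blocks-reprG (at (toℕ y ∷ toℕ x ∷ toℕ i ∷ []))
        (λ z → same gateN (toℕ z ∷ toℕ y ∷ toℕ x ∷ toℕ i ∷ []) (toℕ y ∷ toℕ x ∷ toℕ i ∷ [])) λ z →
      let xs = toℕ z ∷ toℕ y ∷ toℕ x ∷ toℕ i ∷ []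
          es' = trans (evalT-wks xs ts) es in
      gate-reprG (cmpIf (does (next? (read X n off) x y z)) (wire (inject₁ i) s x y) (wire (suc i) s x z))
        (cmpIf-repr (wires-eval xs) {c = nextF (wks 4 tn) (wks 4 toff) v2 v1 v0}
        (det (proof (next? (read X n off) x y z))
          (next-reflects (xs ++ᵛ ρ) {wks 4 tn} {wks 4 toff} (at xs) (trans (evalT-wks xs toff) eo) v2 v1 v0 refl refl refl))
        (wire-eval xs {v3} {wks 4 ts} {v2} {v1} (sym (toℕ-inject₁ i)) es' refl refl)
        (wire-eval xs {`1 ⊕ v3} {wks 4 ts} {v2} {v0} refl es' refl refl))

    sources-repr : ∀ i → ReprG (sourcesC tn tP) (toℕ i ∷ ρ) (sources i)
    sources-repr i =
      blocks-reprG (at (toℕ i ∷ [])) (λ x → same cellN (toℕ x ∷ toℕ i ∷ []) (toℕ i ∷ [])) λ x →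
      blocks-reprG (at (toℕ x ∷ toℕ i ∷ [])) (λ y → same gateN (toℕ y ∷ toℕ x ∷ toℕ i ∷ []) (toℕ x ∷ toℕ i ∷ [])) λ y →
      let xs = toℕ y ∷ toℕ x ∷ toℕ i ∷ [] in
      gate-reprG (ngtIf (does (first? mp x y)) (wire (suc i) zero x y))
        (ngtIf-repr (wires-eval xs) {c = firstF (wks 3 tn) (wks 3 tP) v1 v0}
        (det (proof (first? mp x y))
          (first-reflects (xs ++ᵛ ρ) {wks 3 tn} {wks 3 tP} (at xs) (trans (evalT-wks xs tP) eP) v1 v0 refl refl))
        (wire-eval xs {`1 ⊕ v2} {`0} {v1} {v0} refl refl refl refl))

    layer-repr : ∀ i → ReprG (layerC tn tP tR) (toℕ i ∷ ρ) (layer i)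
    layer-repr i = ⧺-reprG {gs = comparisons i} (comparisons-repr i)
      (⧺-reprG {gs = moves zero mp i} (moves-repr refl eP i)
      (⧺-reprG {gs = moves (suc zero) wp i} (moves-repr refl eR i) (sources-repr i)))

    network-repr : ∀ {ta tb a b} → evalT ta ρ X ≡ toℕ a → evalT tb ρ X ≡ toℕ b →
      Repr (networkC tn tP tR ta tb) ρ
        (encCcv wires (wire (fromℕ rounds) zero a b) (V.replicate wires false) (network a b))
    network-repr {ta} {tb} {a} {b} ea eb =
      ⧺-repr (unary-repr (wires-eval []))
      (⧺-repr (unary-repr output)
      (⧺-repr (subst (Repr _ ρ) (sym (toList-replicate wires false)) (replicate-repr wires (wires-eval []) (λ _ → refl)))
      (⧺-reprG {gs = concat (tabulate layer)}
        (blocks-reprG (cong (λ z → 2 * (z * z)) en)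
          (λ i → same (λ z → rowN z + (z * rowN z + (z * rowN z + rowN z))) (toℕ i ∷ []) []) layer-repr)
        (⧺-reprG {gs = ngt (wire (fromℕ rounds) (suc zero) b a) ∷ []} {hs = last-gate ∷ []}
          (gate-reprG (ngt (wire (fromℕ rounds) (suc zero) b a)) (ngt-repr (wires-eval []) flipped))
          (gate-reprG last-gate (cmp-repr (wires-eval []) output flipped))))))
      where
      last-gate = cmp (wire (fromℕ rounds) zero a b) (wire (fromℕ rounds) (suc zero) b a)
      last-round : evalT (roundsT tn) ρ X ≡ toℕ (fromℕ rounds)
      last-round = trans (cong (λ z → 2 * (z * z)) en) (sym (toℕ-fromℕ rounds))
      output = wire-eval [] {roundsT tn} {`0} {ta} {tb} last-round refl ea eb
      flipped = wire-eval [] {roundsT tn} {`1} {tb} {ta} last-round refl eb ea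

-- The reductions

-- Unary numerals are self-delimiting: the first false bit shows where the rest begins.
unary-injective : ∀ k k' {S S' : Str} → unary k ++ S ≡ unary k' ++ S' → k ≡ k' × S ≡ S'
unary-injective zero    zero     refl = refl , refl
unary-injective (suc k) (suc k') e with unary-injective k k' (proj₂ (∷-injective e))
... | refl , e' = refl , e'

++-injective : ∀ {A : Set} (xs xs' : List A) {ys ys'} → length xs ≡ length xs' → xs ++ ys ≡ xs' ++ ys' → xs ≡ xs' × ys ≡ ys'
++-injective []       []         _ e = refl , e
++-injective (x ∷ xs) (x' ∷ xs') l e with ∷-injective e
... | refl , e' with ++-injective xs xs' (suc-injective l) e'
...   | refl , e'' = refl , e''

oneHot-injective : ∀ (i j : Fin n) → oneHot n i ≡ oneHot n j → i ≡ j
oneHot-injective {n} i j e = toℕ-injective (reflects-elim (eqFin-reflects i j) (trans (sym (at j))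
  (trans (cong (λ S → bit S (toℕ i)) (sym e)) (trans (at i) (reflects-yes (eqFin-reflects i i) refl)))))
  where
  at : ∀ j → bit (oneHot n j) (toℕ i) ≡ eqFin i j
  at j = bit-tabulate (λ a → eqFin a j) i

length-oneHot : ∀ (i : Fin n) → length (oneHot n i) ≡ n
length-oneHot i = length-tabulate (λ k → eqFin k i)

length-encGate : ∀ (g : Gate n) → length (encGate g) ≡ suc (n + n)
length-encGate {n} (cmp i j) = cong suc (trans (length-++ (oneHot n i))
  (cong₂ _+_ (length-oneHot i) (length-oneHot j)))
length-encGate {n} (ngt i) = cong suc (trans (length-++ (oneHot n i))
  (cong₂ _+_ (length-oneHot i) (length-replicate n)))

encGate-injective : ∀ (g h : Gate n) → encGate g ≡ encGate h → g ≡ h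
encGate-injective {n} (cmp i j) (cmp i' j') e
  with ++-injective (oneHot n i) (oneHot n i') (trans (length-oneHot i) (sym (length-oneHot i'))) (proj₂ (∷-injective e))
... | e₁ , e₂ = cong₂ cmp (oneHot-injective i i' e₁) (oneHot-injective j j' e₂)
encGate-injective {n} (ngt i) (ngt i') e
  with ++-injective (oneHot n i) (oneHot n i') (trans (length-oneHot i) (sym (length-oneHot i'))) (proj₂ (∷-injective e))
... | e₁ , _ = cong ngt (oneHot-injective i i' e₁)
encGate-injective (cmp _ _) (ngt _) ()
encGate-injective (ngt _) (cmp _ _) ()

-- All gates on `n` wires have the same positive width, so equal strings are cut at the same places.
encGates-injective : ∀ (gs hs : List (Gate n)) → concatMap encGate gs ≡ concatMap encGate hs → gs ≡ hs
encGates-injective []             []             _ = refl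
encGates-injective []             (cmp _ _ ∷ hs) ()
encGates-injective []             (ngt _ ∷ hs)   ()
encGates-injective (cmp _ _ ∷ gs) []             ()
encGates-injective (ngt _ ∷ gs)   []             ()
encGates-injective (g ∷ gs) (h ∷ hs) e
  with ++-injective (encGate g) (encGate h) (trans (length-encGate g) (sym (length-encGate h))) e
... | e₁ , e₂ = cong₂ _∷_ (encGate-injective g h e₁) (encGates-injective gs hs e₂)

-- `CcvNeg` asks for some decoding of the string. Unique readability shows that it can only be the
-- circuit that was encoded.
ccvNeg-encCcv : ∀ N (d : Fin N) inp gs → CcvNeg (encCcv N d inp gs) ⇔ (vlookup (runCircuit gs inp) d ≡ true)
ccvNeg-encCcv N d inp gs = mk⇔ to (λ h → N , d , inp , gs , refl , h)
  where
  to : CcvNeg (encCcv N d inp gs) → vlookup (runCircuit gs inp) d ≡ true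
  to (N' , d' , inp' , gs' , e , h) with unary-injective N N' e
  ... | refl , e₁ with unary-injective (toℕ d) (toℕ d') e₁
  ...   | ed , e₂ with toℕ-injective ed
  ...     | refl with ++-injective (vtoList inp) (vtoList inp')
                        (trans (length-toList inp) (sym (length-toList inp'))) e₂
  ...       | e₃ , e₄ with trans (sym (cast-is-id refl inp)) (toList-injective refl inp inp' e₃) | encGates-injective gs gs' e₄
  ...         | refl | refl = h

-- Every encoded circuit starts with a nonempty numeral. The empty string thus serves as the
-- negative answer on malformed inputs.
¬ccvNeg-[] : ¬ CcvNeg []
¬ccvNeg-[] (zero  , () , _)
¬ccvNeg-[] (suc n , d , inp , gs , () , _)

-- Instances recovered from strings

_≈ᵖ_ : Pref n → Pref n → Set
p ≈ᵖ q = ∀ a x y → p a x y ≡ q a x y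

≈ᵖ-sym : {p q : Pref n} → p ≈ᵖ q → q ≈ᵖ p
≈ᵖ-sym e a x y = sym (e a x y)

strict-cong : {p q : Pref n} → p ≈ᵖ q → StrictTotalRows p → StrictTotalRows q
strict-cong e (irrefl , transitive , total) =
  (λ a x → trans (sym (e a x x)) (irrefl a x)) ,
  (λ a x y z h h' → trans (sym (e a x z)) (transitive a x y z (trans (e a x y) h) (trans (e a y z) h'))) ,
  (λ a x y ne → Sum.map (trans (sym (e a x y))) (trans (sym (e a y x))) (total a x y ne))

enc3-cong : {p q : Pref n} → p ≈ᵖ q → enc3 n p ≡ enc3 n q
enc3-cong e = cong concat (tabulate-cong λ a → cong concat (tabulate-cong λ b → tabulate-cong λ c → e a b c))

stable-cong : {mp mp' wp wp' : Pref n} → mp ≈ᵖ mp' → wp ≈ᵖ wp' → ∀ {μ} → Stable mp wp μ → Stable mp' wp' μ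
stable-cong em ew (inj , unblocked) = inj , λ { m w (better , l , e , h) →
  unblocked m w (trans (em _ _ _) better , l , e , trans (ew _ _ _) h) }

Optimality : Set₁
Optimality = ∀ {n} → Pref n → Pref n → Marriage n → Set

-- Preferences read back from a string agree with the encoded ones pointwise, not as functions;
-- optimality has to be carried across this weaker agreement.
Extensional : Optimality → Set
Extensional Opt = ∀ {n} {mp mp' wp wp' : Pref n} → mp ≈ᵖ mp' → wp ≈ᵖ wp' → ∀ {μ} → Opt mp wp μ → Opt mp' wp' μ

manOptimal-cong : Extensional ManOptimal
manOptimal-cong em ew (st , best) = stable-cong em ew st , λ ν ν-st m →
  Sum.map₂ (trans (sym (em _ _ _))) (best ν (stable-cong (≈ᵖ-sym em) (≈ᵖ-sym ew) ν-st) m)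

womanOptimal-cong : Extensional WomanOptimal
womanOptimal-cong em ew (st , best) = stable-cong em ew st , λ ν ν-st m m' e →
  Sum.map₂ (trans (sym (ew _ _ _))) (best ν (stable-cong (≈ᵖ-sym em) (≈ᵖ-sym ew) ν-st) m m' e)

menOff womenOff : (n a b : ℕ) → ℕ
menOff n a b = suc n + (suc a + suc b)
womenOff n a b = menOff n a b + n * (n * n)

men women : Str → (n a b : ℕ) → Pref n
men X n a b = read X n (menOff n a b)
women X n a b = read X n (womenOff n a b)

-- The existential over preferences is replaced by a test that a number formula can express:
-- encoding again what is read from `X` must give back `X`.
Instance : Str → (n a b : ℕ) → Set
Instance X n a b =
  X ≡ unary n ++ unary a ++ unary b ++ enc3 n (men X n a b) ++ enc3 n (women X n a b) ×
  StrictTotalRows (men X n a b) × StrictTotalRows (women X n a b)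

length-unary : ∀ k → length (unary k) ≡ suc k
length-unary zero    = refl
length-unary (suc k) = cong suc (length-unary k)

bit-skip : ∀ (S : Str) {S' m} j → length S ≡ m → bit (S ++ S') (m + j) ≡ bit S' j
bit-skip S j refl = bit-++ʳ S j

length-enc3 : ∀ (p : Pref n) → length (enc3 n p) ≡ n * (n * n)
length-enc3 p = length-blocks _ λ a → length-blocks _ λ b → length-tabulate (p a b)

bit-enc3 : ∀ (p : Pref n) {S} a x y → bit (enc3 n p ++ S) (toℕ a * (n * n) + (toℕ x * n + toℕ y)) ≡ p a x y
bit-enc3 {n} p {S} a x y = trans (bit-++ˡ (enc3 n p) in-enc3)
  (trans (bit-blocks _ (λ a → length-blocks _ λ b → length-tabulate (p a b)) a in-row)
  (trans (bit-blocks _ (λ b → length-tabulate (p a b)) x (toℕ<n y)) (bit-tabulate (p a x) y)))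
  where
  block-< : ∀ {u r} (a : Fin n) → r < u → toℕ a * u + r < n * u
  block-< {u} {r} a lt = ≤-trans (+-monoʳ-< (toℕ a * u) lt)
    (≤-trans (≤-reflexive (+-comm (toℕ a * u) u)) (*-monoˡ-≤ u (toℕ<n a)))
  in-row : toℕ x * n + toℕ y < n * n
  in-row = block-< x (toℕ<n y)
  in-enc3 : toℕ a * (n * n) + (toℕ x * n + toℕ y) < length (enc3 n p)
  in-enc3 = subst (_ <_) (sym (length-enc3 p)) (block-< a in-row)

module _ {n} (a b : ℕ) (mp wp : Pref n) where
  private
    X = unary n ++ unary a ++ unary b ++ enc3 n mp ++ enc3 n wp

    bit-body : ∀ j → bit X (menOff n a b + j) ≡ bit (enc3 n mp ++ enc3 n wp) j
    bit-body j = trans (cong (bit X) (trans (+-assoc (suc n) (suc a + suc b) j)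
                                     (cong (suc n +_) (+-assoc (suc a) (suc b) j))))
      (trans (bit-skip (unary n) _ (length-unary n))
      (trans (bit-skip (unary a) _ (length-unary a)) (bit-skip (unary b) j (length-unary b))))

  men-encSM : men X n a b ≈ᵖ mp
  men-encSM x y z = trans (bit-body _) (bit-enc3 mp x y z)

  women-encSM : women X n a b ≈ᵖ wp
  women-encSM x y z = trans (cong (bit X) (+-assoc (menOff n a b) (n * (n * n)) _))
    (trans (bit-body _) (trans (bit-skip (enc3 n mp) _ (length-enc3 mp))
    (trans (cong (λ S → bit S i) (sym (++-identityʳ (enc3 n wp)))) (bit-enc3 wp x y z))))
    where i = toℕ x * (n * n) + (toℕ y * n + toℕ z)

  encoded-instance : StrictTotalRows mp → StrictTotalRows wp → Instance X n a b
  encoded-instance m-strict w-strict =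
    cong₂ (λ S S' → unary n ++ unary a ++ unary b ++ S ++ S')
      (enc3-cong (≈ᵖ-sym men-encSM)) (enc3-cong (≈ᵖ-sym women-encSM)) ,
    strict-cong (≈ᵖ-sym men-encSM) m-strict , strict-cong (≈ᵖ-sym women-encSM) w-strict

instance-unique : ∀ {X n a b n' a' b'} → Instance X n a b → Instance X n' a' b' → n ≡ n' × a ≡ a' × b ≡ b'
instance-unique {n = n} {a} {b} {n'} {a'} {b'} (e , _) (e' , _)
  with refl , e₁ ← unary-injective n n' (trans (sym e) e')
  with refl , e₂ ← unary-injective a a' e₁
  with refl , _ ← unary-injective b b' e₂
  = refl , refl , refl

instance-size : ∀ {X n a b} → Instance X n a b → n ≤ length X
instance-size {X} {n} {a} {b} (e , _) = subst (λ S → n ≤ length S) (sym e)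
  (subst (n ≤_) (sym (length-++ (unary n))) (≤-trans (subst (n ≤_) (sym (length-unary n)) (n≤1+n n)) (m≤m+n _ _)))

isX : Code k → Form k
isX c = conj (eq ∣X∣ (len c)) (∀< ∣X∣ (conj (disj (neg (mem v0)) (bits c)) (disj (neg (bits c)) (mem v0))))

isX-reflects : ∀ X {ρ : Vec ℕ k} {c S} → Semantics.Repr X c ρ S → Reflects (X ≡ S) (evalF (isX c) ρ X)
isX-reflects X {ρ} {c} {S} r = reflects-map to from
  (eq-reflects ρ ∣X∣ (len c) refl (sym (lenOK r)) ×-reflects
   ∀<-reflects ρ ∣X∣ (conj (disj (neg (mem v0)) (bits c)) (disj (neg (bits c)) (mem v0))) refl (λ i →
     (reflects-true (bit X (toℕ i)) →-reflects reflects-true (evalF (bits c) (toℕ i ∷ ρ) X)) ×-reflects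
     (reflects-true (evalF (bits c) (toℕ i ∷ ρ) X) →-reflects reflects-true (bit X (toℕ i)))))
  where
  open Semantics X
  Same = length X ≡ length S × (∀ (i : Fin (length X)) →
    (bit X (toℕ i) ≡ true → evalF (bits c) (toℕ i ∷ ρ) X ≡ true) ×
    (evalF (bits c) (toℕ i ∷ ρ) X ≡ true → bit X (toℕ i) ≡ true))

  to : Same → X ≡ S
  to (e , same) = str-ext e λ i lt →
    subst (λ j → bit X j ≡ bit S j) (toℕ-fromℕ< lt)
      (trans (det (reflects-map (proj₁ (same (fromℕ< lt))) (proj₂ (same (fromℕ< lt))) (reflects-true _)) (reflects-true _))
        (sym (bitsOK r _ (subst (_< length S) (sym (toℕ-fromℕ< lt)) (subst (i <_) e lt)))))

  from : X ≡ S → Same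
  from e = cong length e , λ i →
    let at = trans (cong (λ Y → bit Y (toℕ i)) e) (bitsOK r (toℕ i) (subst (λ Y → toℕ i < length Y) e (toℕ<n i)))
    in trans (sym at) , trans at

menOffT womenOffT : Term 3
menOffT = (`1 ⊕ v0) ⊕ ((`1 ⊕ v1) ⊕ (`1 ⊕ v2))
womenOffT = menOffT ⊕ (v0 ⊗ (v0 ⊗ v0))

instanceC : Code 3
instanceC = unaryC v0 ⧺ unaryC v1 ⧺ unaryC v2 ⧺ enc3C v0 menOffT ⧺ enc3C v0 womenOffT

instanceF : Form 3
instanceF = conj (leq (`1 ⊕ v1) v0) (conj (leq (`1 ⊕ v2) v0)
  (conj (isX instanceC) (conj (strictF v0 menOffT) (strictF v0 womenOffT))))

instance-reflects : ∀ X n a b → Reflects (a < n × b < n × Instance X n a b) (evalF instanceF (n ∷ a ∷ b ∷ []) X)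
instance-reflects X n a b =
  leq-reflects ρ (`1 ⊕ v1) v0 refl refl ×-reflects (leq-reflects ρ (`1 ⊕ v2) v0 refl refl ×-reflects
  (isX-reflects X {ρ} {instanceC} instance-repr
   ×-reflects (strict-reflects ρ {v0} {menOffT} refl refl ×-reflects strict-reflects ρ {v0} {womenOffT} refl refl)))
  where
  open Semantics X
  open Preferences X
  ρ = n ∷ a ∷ b ∷ []
  instance-repr : Repr instanceC ρ (unary n ++ unary a ++ unary b ++ enc3 n (men X n a b) ++ enc3 n (women X n a b))
  instance-repr = ⧺-repr (unary-repr refl) (⧺-repr (unary-repr refl) (⧺-repr (unary-repr refl)
    (⧺-repr (enc3-repr ρ {v0} {menOffT} refl refl) (enc3-repr ρ {v0} {womenOffT} refl refl))))

-- Unfolds to `MoSm` for `ManOptimal` and to `WoSm` for `WomanOptimal`, so one reduction scheme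
-- serves both problems.
StableMarriage : Optimality → Str → Set
StableMarriage Opt X = ∃[ n ] Σ (Fin n) λ a → Σ (Fin n) λ b → Σ (Pref n) λ mp → Σ (Pref n) λ wp →
  X ≡ encSM n a b mp wp × StrictTotalRows mp × StrictTotalRows wp ×
  ∃[ μ ] (Opt mp wp μ × μ a ≡ b)

module Reduction
  {Opt : Optimality} (ext : Extensional Opt) (c : Code 3) (target : Str → ∀ n → Fin n → Fin n → Str)
  (target-repr : ∀ X n a b → Semantics.Repr X c (n ∷ toℕ a ∷ toℕ b ∷ []) (target X n a b))
  (target-correct : ∀ X n a b → Instance X n (toℕ a) (toℕ b) →
    (∃[ μ ] (Opt (men X n (toℕ a) (toℕ b)) (women X n (toℕ a) (toℕ b)) μ × μ a ≡ b)) ⇔ CcvNeg (target X n a b))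
  where

  Parsed : Str → Set
  Parsed X = ∃[ n ] Σ (Fin n) λ a → Σ (Fin n) λ b → Instance X n (toℕ a) (toℕ b)

  parsed⇒holds : ∀ X ((n , a , b , _) : Parsed X) → evalF instanceF (n ∷ toℕ a ∷ toℕ b ∷ []) X ≡ true
  parsed⇒holds X (n , a , b , i) = reflects-yes (instance-reflects X n (toℕ a) (toℕ b)) (toℕ<n a , toℕ<n b , i)

  holds⇒parsed : ∀ X n a b → evalF instanceF (n ∷ a ∷ b ∷ []) X ≡ true →
    Σ (Fin n) λ a' → Σ (Fin n) λ b' → toℕ a' ≡ a × toℕ b' ≡ b × Instance X n (toℕ a') (toℕ b')
  holds⇒parsed X n a b h = let (a<n , b<n , i) = reflects-elim (instance-reflects X n a b) h in
        fromℕ< a<n , fromℕ< b<n , toℕ-fromℕ< a<n , toℕ-fromℕ< b<n ,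
        subst₂ (Instance X n) (sym (toℕ-fromℕ< a<n)) (sym (toℕ-fromℕ< b<n)) i

  small : ∀ X n a b → evalF instanceF (n ∷ a ∷ b ∷ []) X ≡ true → n ≤ length X × a ≤ length X × b ≤ length X
  small X n a b h =
    let (a<n , b<n , i) = reflects-elim (instance-reflects X n a b) h
        n≤ = instance-size {X} {n} {a} {b} i
    in n≤ , ≤-trans (<⇒≤ a<n) n≤ , ≤-trans (<⇒≤ b<n) n≤

  parse : ∀ X → Dec (Parsed X)
  parse X = map′
    (λ { (n , a , b , h) → let (a' , b' , _ , _ , i) = holds⇒parsed X n a b h in n , a' , b' , i })
    (λ { p@(n , a , b , _) → n , toℕ a , toℕ b , parsed⇒holds X p })
    (satisfiable? instanceF X (small X))

  -- The decision is an argument, so that properties of the output are proved by cases on an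
  -- arbitrary decision.
  emit : ∀ X → Dec (Parsed X) → Str
  emit X (yes (n , a , b , _)) = target X n a b
  emit X (no _)                = []

  -- The parse inside the decision need not be the given one a priori; the self-delimiting header
  -- forces the two to have the same numbers.
  emit-parsed : ∀ X d n a b → Instance X n (toℕ a) (toℕ b) → emit X d ≡ target X n a b
  emit-parsed X (no unparsed) n a b i = ⊥-elim (unparsed (n , a , b , i))
  emit-parsed X (yes (n' , a' , b' , i')) n a b i with instance-unique {X} {n} {_} {_} {n'} i i'
  ... | refl , ea , eb with toℕ-injective ea | toℕ-injective eb
  ...   | refl | refl = refl

  emit-unparsed : ∀ X d → ¬ Parsed X → emit X d ≡ []
  emit-unparsed X (no _)  unparsed = refl
  emit-unparsed X (yes p) unparsed = ⊥-elim (unparsed p)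

  emit-sound : ∀ X d → CcvNeg (emit X d) → StableMarriage Opt X
  emit-sound X (no _) h = ⊥-elim (¬ccvNeg-[] h)
  emit-sound X (yes (n , a , b , i@(e , m-strict , w-strict))) h =
    n , a , b , _ , _ , e , m-strict , w-strict , Equivalence.from (target-correct X n a b i) h

  F : Str → Str
  F X = emit X (parse X)

  F-parsed : ∀ X n a b → Instance X n (toℕ a) (toℕ b) → F X ≡ target X n a b
  F-parsed X = emit-parsed X (parse X)

  F-ac0 : IsAC0 F
  F-ac0 = ac0-by-cases instanceF c F small on (λ X none → emit-unparsed X (parse X) (λ { p@(n , a , b , _) → none n (toℕ a) (toℕ b) (parsed⇒holds X p) }))
    where
    on : ∀ X n a b → evalF instanceF (n ∷ a ∷ b ∷ []) X ≡ true → Semantics.Repr X c (n ∷ a ∷ b ∷ []) (F X)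
    on X n a b h =
      let (a' , b' , ea , eb , i) = holds⇒parsed X n a b h in
      subst₂ (λ a b → Semantics.Repr X c (n ∷ a ∷ b ∷ []) (F X)) ea eb
        (subst (Semantics.Repr X c _) (sym (F-parsed X n a' b' i)) (target-repr X n a' b'))

  reducible : StableMarriage Opt ≤AC0 CcvNeg
  reducible = F , F-ac0 , λ X → mk⇔ (to X) (emit-sound X (parse X))
    where
    to : ∀ X → StableMarriage Opt X → CcvNeg (F X)
    to X (n , a , b , mp , wp , refl , m-strict , w-strict , μ , opt , e) =
      -- The circuit is built from the preferences read from `X`, so optimality is first transported
      -- to them. The converse direction simply returns these preferences as witnesses.
      subst CcvNeg (sym (F-parsed X n a b i)) (Equivalence.to (target-correct X n a b i)
        (μ , ext (≈ᵖ-sym (men-encSM (toℕ a) (toℕ b) mp wp)) (≈ᵖ-sym (women-encSM (toℕ a) (toℕ b) mp wp)) opt , e))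
      where i = encoded-instance (toℕ a) (toℕ b) mp wp m-strict w-strict

network-string : (mp wp : Pref n) → Fin n → Fin n → Str
network-string {n} mp wp a b = encCcv wires (wire (fromℕ rounds) zero a b) (V.replicate wires false) (network a b)
  where
  open Network mp wp
  open DeferredAcceptance mp wp using (rounds)

network-decides : ∀ {mp wp : Pref n} → StrictTotalRows mp → StrictTotalRows wp → ∀ a b →
  (∃[ μ ] (ManOptimal mp wp μ × μ a ≡ b)) ⇔ CcvNeg (network-string mp wp a b)
network-decides {n} {mp} {wp} m-strict w-strict a b = mk⇔
  (λ o → Equivalence.from ccv (reflects-yes correct (proj₂ matched o)))
  (λ h → proj₁ matched (reflects-elim correct (Equivalence.to ccv h)))
  where
  open Network mp wp
  open DeferredAcceptance mp wp
  matched = matched⇔optimal m-strict w-strict a b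
  correct = network-correct m-strict w-strict a b
  ccv = ccvNeg-encCcv wires (wire (fromℕ rounds) zero a b) (V.replicate wires false) (network a b)

theorem49 : (MoSm ≤AC0 CcvNeg) × (WoSm ≤AC0 CcvNeg)
theorem49 =
  Reduction.reducible manOptimal-cong (networkC v0 menOffT womenOffT v1 v2)
    (λ X n a b → network-string (men X n (toℕ a) (toℕ b)) (women X n (toℕ a) (toℕ b)) a b)
    (λ X n a b → Gates.network-repr X (n ∷ toℕ a ∷ toℕ b ∷ []) refl refl refl refl refl)
    (λ X n a b (_ , m-strict , w-strict) → network-decides m-strict w-strict a b) ,
  -- The women propose: the two preference offsets and the two members of the designated pair trade
  -- places.
  Reduction.reducible womanOptimal-cong (networkC v0 womenOffT menOffT v2 v1)
    (λ X n a b → network-string (women X n (toℕ a) (toℕ b)) (men X n (toℕ a) (toℕ b)) b a)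
    (λ X n a b → Gates.network-repr X (n ∷ toℕ a ∷ toℕ b ∷ []) refl refl refl refl refl)
    (λ X n a b (_ , m-strict , w-strict) →
      let decides = network-decides w-strict m-strict b a in
      mk⇔ (Equivalence.to decides ∘ womanOptimal⇒swapped) (swapped⇒womanOptimal ∘ Equivalence.from decides))
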